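{- Let $K$ be a real quadratic field and $R$ its ring of integers. For a unit $\alpha\in R\setminus\{\pm1\}$, let $\Delta=(\Delta_n)_{n\geqslant1}$ be the integer sequence $\Delta_n=N_{K/\mathbb{Q}}(\alpha^n-1)$. Then: (i) there exists a positive integer $C_1$ such that for all units $\alpha\in R\setminus\{\pm1\}$ of norm $1$, $Z(\Delta)\leqslant C_1$; (ii) there exists a positive integer $C_2$ such that for all units $\alpha\in R\setminus\{\pm1\}$ of norm $-1$, $\Delta_n$ has a primitive prime divisor for every $n>C_2$ with $n\not\equiv2\pmod4$.
   Context: For an integer sequence $A=(a_n)_{n\geqslant1}$, a prime $p$ dividing $a_n$ is called a primitive prime divisor of $a_n$ if $p$ does not divide $a_m$ for any $m<n$ with $a_m\neq0$. The Zsigmondy bound of $A$ is $Z(A)=\max\{n: a_n\text{ does not have a primitive prime divisor}\}$ if this set is finite, and $Z(A)=\infty$ otherwise; if the set is empty, any inequality $Z(A)\leqslant c$ with $c>0$ is regarded as true. Norm means the field norm $N_{K/\mathbb{Q}}$. -}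

module Defs where

open import Algebra.Bundles using (CommutativeRing)
import Algebra.Properties.Semiring.Exp as Exp
import Algebra.Properties.Monoid.Sum as Sum
import Algebra.Properties.Ring as RingP
import Algebra.Properties.Semiring.Sum as SSum
open import Data.Empty using (⊥-elim)
open import Data.Fin.Base as Fin using (Fin; toℕ)
import Data.Fin.Properties as Fin
open import Data.Integer.Base as ℤ using (ℤ; +_; 0ℤ)
import Data.Integer.Properties as ℤ
import Data.Integer.Divisibility as ℤ∣
open import Data.Nat.Base as ℕ using (ℕ; zero; suc; z≤n; s≤s)
import Data.Nat.Properties as ℕ
import Data.Nat.Divisibility as ℕ∣
open import Data.Nat.Coprimality as Coprime using (Coprime; coprime-divisor)
open import Data.Nat.Induction using (<-rec)
open import Data.Nat.Primality using (Prime)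
open import Data.Product.Base using (Σ; ∃; _×_; _,_; proj₁; proj₂)
open import Data.Rational.Base as ℚ using (ℚ; 0ℚ; 1ℚ; ↥_; ↧_; ↧ₙ_; _/_; toℚᵘ; fromℚᵘ)
import Data.Rational.Properties as ℚ
import Data.Rational.Solver as ℚ
open import Data.Rational.Unnormalised.Base as ℚᵘ using (mkℚᵘ; *≡*)
import Data.Rational.Unnormalised.Properties as ℚᵘ
open import Data.Sum.Base using (_⊎_)
open import Level using (0ℓ)
open import Relation.Binary.PropositionalEquality
open import Relation.Nullary using (¬_; yes; no)
open import Relation.Unary using (Pred; Empty)

-- A sequence indexed by n ≥ 1 is a function on ℕ whose value at 0 is ignored.

IsPrimitivePrimeDivisor : (ℕ → ℤ) → ℕ → ℕ → Set
IsPrimitivePrimeDivisor a n p =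
  Prime p × (+ p) ℤ∣.∣ a n ×
  (∀ m → 1 ℕ.≤ m → m ℕ.< n → a m ≢ 0ℤ → ¬ ((+ p) ℤ∣.∣ a m))

HasPrimitivePrimeDivisor : (ℕ → ℤ) → ℕ → Set
HasPrimitivePrimeDivisor a n = ∃ λ p → IsPrimitivePrimeDivisor a n p

ZsigmondySet : (ℕ → ℤ) → Pred ℕ 0ℓ
ZsigmondySet a n = 1 ℕ.≤ n × ¬ HasPrimitivePrimeDivisor a n

IsMaximumOf : Pred ℕ 0ℓ → ℕ → Set
IsMaximumOf P z = P z × (∀ n → P n → n ℕ.≤ z)

-- Z(a) ≤ c for c > 0: it holds by convention when the Zsigmondy set is
-- empty, and fails when the set is infinite (no maximum, Z(a) = ∞).

Z[_]≤_ : (ℕ → ℤ) → ℕ → Set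
Z[ a ]≤ c =
  Empty (ZsigmondySet a) ⊎
  ∃ λ z → IsMaximumOf (ZsigmondySet a) z × z ℕ.≤ c

-- The field ℚ(√d), for a natural number d that is not a square.

record RealQuadraticField : Set where
  constructor ℚ[√_]
  field
    d         : ℕ
    nonSquare : ∀ m → m ℕ.* m ≢ d

ι : ℤ → ℚ
ι z = z / 1

module QuadraticField (K : RealQuadraticField) where

  open RealQuadraticField K using (d)

  infixl 7 _*_
  infixl 6 _+_ _-_
  infix  8 -_

  -- x +√d y is the element x + y√d.

  infix 5 _+√d_

  record Carrier : Set where
    constructor _+√d_
    field
      re im : ℚ

  open Carrier public

  D : ℚ
  D = ι (+ d)

  -_ : Carrier → Carrier
  - x = ℚ.- re x +√d ℚ.- im x

  _+_ _*_ : Carrier → Carrier → Carrier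
  x + y = re x ℚ.+ re y +√d im x ℚ.+ im y
  x * y = re x ℚ.* re y ℚ.+ D ℚ.* (im x ℚ.* im y)
          +√d re x ℚ.* im y ℚ.+ im x ℚ.* re y

  _-_ : Carrier → Carrier → Carrier
  x - y = x + (- y)

  0# 1# √d : Carrier
  0# = 0ℚ +√d 0ℚ
  1# = 1ℚ +√d 0ℚ
  √d = 0ℚ +√d 1ℚ

  fromℤ : ℤ → Carrier
  fromℤ z = ι z +√d 0ℚ

  open ℚ.+-*-Solver using (solve; _:=_; con)
    renaming (_:+_ to _⊕_; _:*_ to _⊗_; :-_ to ⊖_; _:-_ to _⊝_)

  commutativeRing : CommutativeRing 0ℓ 0ℓ
  commutativeRing = record
    { Carrier = Carrier
    ; _≈_ = _≡_
    ; _+_ = _+_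
    ; _*_ = _*_
    ; -_  = -_
    ; 0#  = 0#
    ; 1#  = 1#
    ; isCommutativeRing = record
      { isRing = record
        { +-isAbelianGroup = record
          { isGroup = record
            { isMonoid = record
              { isSemigroup = record
                { isMagma = record
                  { isEquivalence = isEquivalence
                  ; ∙-cong = cong₂ _+_
                  }
                ; assoc = λ x y z → cong₂ _+√d_
                    (ℚ.+-assoc (re x) (re y) (re z))
                    (ℚ.+-assoc (im x) (im y) (im z))
                }
              ; identity =
                  (λ x → cong₂ _+√d_ (ℚ.+-identityˡ (re x)) (ℚ.+-identityˡ (im x)))
                , (λ x → cong₂ _+√d_ (ℚ.+-identityʳ (re x)) (ℚ.+-identityʳ (im x)))
              }
            ; inverse =
                (λ x → cong₂ _+√d_ (ℚ.+-inverseˡ (re x)) (ℚ.+-inverseˡ (im x)))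
              , (λ x → cong₂ _+√d_ (ℚ.+-inverseʳ (re x)) (ℚ.+-inverseʳ (im x)))
            ; ⁻¹-cong = cong (λ x → - x)
            }
          ; comm = λ x y → cong₂ _+√d_
              (ℚ.+-comm (re x) (re y)) (ℚ.+-comm (im x) (im y))
          }
        ; *-cong = cong₂ _*_
        ; *-assoc = *-assoc
        ; *-identity = *-identityˡ , λ x → trans (*-comm x 1#) (*-identityˡ x)
        ; distrib = *-distribˡ-+ , λ x y z →
            trans (*-comm (y + z) x)
              (trans (*-distribˡ-+ x y z) (cong₂ _+_ (*-comm x y) (*-comm x z)))
        }
      ; *-comm = *-comm
      }
    }
    where
    *-comm : ∀ x y → x * y ≡ y * x
    *-comm x y = cong₂ _+√d_
      (solve 5 (λ e a b p q → a ⊗ p ⊕ e ⊗ (b ⊗ q) := p ⊗ a ⊕ e ⊗ (q ⊗ b)) refl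
        D (re x) (im x) (re y) (im y))
      (solve 4 (λ a b p q → a ⊗ q ⊕ b ⊗ p := p ⊗ b ⊕ q ⊗ a) refl
        (re x) (im x) (re y) (im y))

    *-identityˡ : ∀ x → 1# * x ≡ x
    *-identityˡ x = cong₂ _+√d_
      (solve 3 (λ e a b → con 1ℚ ⊗ a ⊕ e ⊗ (con 0ℚ ⊗ b) := a) refl D (re x) (im x))
      (solve 2 (λ a b → con 1ℚ ⊗ b ⊕ con 0ℚ ⊗ a := b) refl (re x) (im x))

    *-assoc : ∀ x y z → (x * y) * z ≡ x * (y * z)
    *-assoc x y z = cong₂ _+√d_
      (solve 7 (λ e a b p q u v →
          (a ⊗ p ⊕ e ⊗ (b ⊗ q)) ⊗ u ⊕ e ⊗ ((a ⊗ q ⊕ b ⊗ p) ⊗ v)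
          := a ⊗ (p ⊗ u ⊕ e ⊗ (q ⊗ v)) ⊕ e ⊗ (b ⊗ (p ⊗ v ⊕ q ⊗ u))) refl
        D (re x) (im x) (re y) (im y) (re z) (im z))
      (solve 7 (λ e a b p q u v →
          (a ⊗ p ⊕ e ⊗ (b ⊗ q)) ⊗ v ⊕ (a ⊗ q ⊕ b ⊗ p) ⊗ u
          := a ⊗ (p ⊗ v ⊕ q ⊗ u) ⊕ b ⊗ (p ⊗ u ⊕ e ⊗ (q ⊗ v))) refl
        D (re x) (im x) (re y) (im y) (re z) (im z))

    *-distribˡ-+ : ∀ x y z → x * (y + z) ≡ x * y + x * z
    *-distribˡ-+ x y z = cong₂ _+√d_
      (solve 7 (λ e a b p q u v →
          a ⊗ (p ⊕ u) ⊕ e ⊗ (b ⊗ (q ⊕ v))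
          := (a ⊗ p ⊕ e ⊗ (b ⊗ q)) ⊕ (a ⊗ u ⊕ e ⊗ (b ⊗ v))) refl
        D (re x) (im x) (re y) (im y) (re z) (im z))
      (solve 6 (λ a b p q u v →
          a ⊗ (q ⊕ v) ⊕ b ⊗ (p ⊕ u)
          := (a ⊗ q ⊕ b ⊗ p) ⊕ (a ⊗ v ⊕ b ⊗ u)) refl
        (re x) (im x) (re y) (im y) (re z) (im z))

  open CommutativeRing commutativeRing public using (semiring; +-monoid)
  open Exp semiring public using (_^_)
  open Sum +-monoid public using (sum)

  -- The field norm N_{K/ℚ}(x): the determinant of multiplication by x in
  -- the ℚ-basis 1, √d.

  norm : Carrier → ℚ
  norm x = re (x * 1#) ℚ.* im (x * √d) ℚ.- re (x * √d) ℚ.* im (x * 1#)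

  -- x is a root of a monic polynomial T^k + Σ_{i<k} cᵢ T^i over ℤ.

  IsIntegral : Carrier → Set
  IsIntegral x = ∃ λ k → Σ (Fin k → ℤ) λ c →
    x ^ k + sum (λ i → fromℤ (c i) * x ^ toℕ i) ≡ 0#

  𝓞 : Set
  𝓞 = Σ Carrier IsIntegral

  ⟦_⟧ : 𝓞 → Carrier
  ⟦_⟧ = proj₁

  IsUnit : 𝓞 → Set
  IsUnit α = ∃ λ (β : 𝓞) → ⟦ α ⟧ * ⟦ β ⟧ ≡ 1#

  -- The norm of αⁿ − 1 is a rational number with denominator 1, so it is
  -- read off as an integer by its numerator (Integrality.Δ-norm).

  Δ : 𝓞 → ℕ → ℤ
  Δ α n = ↥ norm (⟦ α ⟧ ^ n - 1#)

toℚᵘ-ι : ∀ z → toℚᵘ (ι z) ℚᵘ.≃ mkℚᵘ z 0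
toℚᵘ-ι z = ℚ.toℚᵘ-fromℚᵘ (mkℚᵘ z 0)

ι-+ : ∀ a b → ι a ℚ.+ ι b ≡ ι (a ℤ.+ b)
ι-+ a b = ℚ.toℚᵘ-injective
  (ℚᵘ.≃-trans (ℚ.toℚᵘ-homo-+ (ι a) (ι b))
  (ℚᵘ.≃-trans (ℚᵘ.+-cong (toℚᵘ-ι a) (toℚᵘ-ι b))
  (ℚᵘ.≃-trans (*≡* (cong (ℤ._* + 1) (cong₂ ℤ._+_ (ℤ.*-identityʳ a) (ℤ.*-identityʳ b))))
  (ℚᵘ.≃-sym (toℚᵘ-ι (a ℤ.+ b))))))

ι-* : ∀ a b → ι a ℚ.* ι b ≡ ι (a ℤ.* b)
ι-* a b = ℚ.toℚᵘ-injective
  (ℚᵘ.≃-trans (ℚ.toℚᵘ-homo-* (ι a) (ι b))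
  (ℚᵘ.≃-trans (ℚᵘ.*-cong (toℚᵘ-ι a) (toℚᵘ-ι b))
  (ℚᵘ.≃-sym (toℚᵘ-ι (a ℤ.* b)))))

ι-neg : ∀ a → ℚ.- ι a ≡ ι (ℤ.- a)
ι-neg a = ℚ.toℚᵘ-injective
  (ℚᵘ.≃-trans (ℚ.toℚᵘ-homo‿- (ι a))
  (ℚᵘ.≃-trans (ℚᵘ.-‿cong (toℚᵘ-ι a))
  (ℚᵘ.≃-sym (toℚᵘ-ι (ℤ.- a)))))

ι-injective : ∀ {a b} → ι a ≡ ι b → a ≡ b
ι-injective {a} {b} eq with
  ℚᵘ.≃-trans (ℚᵘ.≃-sym (toℚᵘ-ι a)) (ℚᵘ.≃-trans (ℚ.toℚᵘ-cong eq) (toℚᵘ-ι b))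
... | *≡* e = trans (sym (ℤ.*-identityʳ a)) (trans e (ℤ.*-identityʳ b))

q*↧q≡↥q : ∀ q → q ℚ.* ι (↧ q) ≡ ι (↥ q)
q*↧q≡↥q q@record{} = ℚ.toℚᵘ-injective
  (ℚᵘ.≃-trans (ℚ.toℚᵘ-homo-* q (ι (↧ q)))
  (ℚᵘ.≃-trans (ℚᵘ.*-congˡ {toℚᵘ q} (toℚᵘ-ι (↧ q)))
  (ℚᵘ.≃-trans (*≡* (trans (ℤ.*-identityʳ _)
      (cong (↥ q ℤ.*_) (cong +_ (sym (ℕ.*-identityʳ (↧ₙ q)))))))
  (ℚᵘ.≃-sym (toℚᵘ-ι (↥ q))))))

↥-ι : ∀ z → ↥ ι z ≡ z
↥-ι z = cong ↥_ (ℚ.↥p/↧p≡p (ℚ.mkℚ z 0 (Coprime.sym (Coprime.1-coprimeTo ℤ.∣ z ∣))))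

↧-coprime-↥ : ∀ q → Coprime (↧ₙ q) ℤ.∣ ↥ q ∣
↧-coprime-↥ (ℚ.mkℚ _ _ c) = Coprime.sym (Coprime.recompute c)

IsInt : ℚ → Set
IsInt q = ∃ λ z → q ≡ ι z

ι-↥ : ∀ {q} → IsInt q → ι (↥ q) ≡ q
ι-↥ (z , refl) = cong ι (↥-ι z)

int-+ : ∀ {p q} → IsInt p → IsInt q → IsInt (p ℚ.+ q)
int-+ (a , refl) (b , refl) = a ℤ.+ b , ι-+ a b

int-* : ∀ {p q} → IsInt p → IsInt q → IsInt (p ℚ.* q)
int-* (a , refl) (b , refl) = a ℤ.* b , ι-* a b

int-neg : ∀ {p} → IsInt p → IsInt (ℚ.- p)
int-neg (a , refl) = ℤ.- a , ι-neg a

-- A rational number whose powers have bounded denominators is an integer.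

module ℚExp = Exp (CommutativeRing.semiring ℚ.+-*-commutativeRing)

n<2^n : ∀ n → n ℕ.< 2 ℕ.^ n
n<2^n zero    = s≤s z≤n
n<2^n (suc n) = ℕ.≤-trans (ℕ.+-mono-≤ (ℕ.m^n>0 2 n) (n<2^n n))
  (ℕ.≤-reflexive (cong (2 ℕ.^ n ℕ.+_) (sym (ℕ.+-identityʳ (2 ℕ.^ n)))))

coprime-^ : ∀ {q p} → Coprime q p → ∀ t → Coprime (q ℕ.^ t) p
coprime-^ c zero    = Coprime.1-coprimeTo _
coprime-^ {q} c (suc t) {e} (e∣q^ , e∣p) = coprime-^ c t (coprime-divisor e⊥q e∣q^ , e∣p)
  where
  e⊥q : Coprime e q
  e⊥q (f∣e , f∣q) = c (f∣q , ℕ∣.∣-trans f∣e e∣p)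

∣p^s*N⇒∣N : ∀ {Q p N} → Coprime Q p → ∀ s → Q ℕ∣.∣ p ℕ.^ s ℕ.* N → Q ℕ∣.∣ N
∣p^s*N⇒∣N {Q} {p} {N} c zero    h = subst (Q ℕ∣.∣_) (ℕ.+-identityʳ N) h
∣p^s*N⇒∣N {Q} {p} {N} c (suc s) h = ∣p^s*N⇒∣N c s
  (coprime-divisor c (subst (Q ℕ∣.∣_) (ℕ.*-assoc p (p ℕ.^ s) N) h))

powers-bounded : ∀ {q p} N .{{_ : ℕ.NonZero N}} → 1 ℕ.≤ q → Coprime q p →
  (∀ t → q ℕ.^ t ℕ∣.∣ p ℕ.^ t ℕ.* N) → q ≡ 1
powers-bounded {suc zero}          N _ c h = refl
powers-bounded {q@(suc (suc _))} N _ c h = ⊥-elim (ℕ.<-irrefl refl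
  (ℕ.<-≤-trans (n<2^n N) (ℕ.≤-trans (ℕ.^-monoˡ-≤ N (s≤s (s≤s z≤n)))
    (ℕ∣.∣⇒≤ (∣p^s*N⇒∣N (coprime-^ c N) N (h N))))))

ι-^ : ∀ a t → ι a ℚExp.^ t ≡ ι (a ℤ.^ t)
ι-^ a zero    = refl
ι-^ a (suc t) = trans (cong (ι a ℚ.*_) (ι-^ a t)) (ι-* a (a ℤ.^ t))

abs-^ : ∀ a t → ℤ.∣ a ℤ.^ t ∣ ≡ ℤ.∣ a ∣ ℕ.^ t
abs-^ a zero    = refl
abs-^ a (suc t) = trans (ℤ.abs-* a (a ℤ.^ t)) (cong (ℤ.∣ a ∣ ℕ.*_) (abs-^ a t))

*-^ : ∀ p q t → (p ℚ.* q) ℚExp.^ t ≡ (p ℚExp.^ t) ℚ.* (q ℚExp.^ t)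
*-^ p q zero    = refl
*-^ p q (suc t) = trans (cong ((p ℚ.* q) ℚ.*_) (*-^ p q t))
  (solve 4 (λ a b c e → (a :* b) :* (c :* e) := (a :* c) :* (b :* e)) refl
    p q (p ℚExp.^ t) (q ℚExp.^ t))
  where open ℚ.+-*-Solver

bounded-denominators⇒int : ∀ (M : ℕ) .{{_ : ℕ.NonZero M}} r →
  (∀ t → IsInt (ι (+ M) ℚ.* (r ℚExp.^ t))) → IsInt r
bounded-denominators⇒int M r h = ↥ r , trans (sym (ℚ.*-identityʳ r))
    (trans (cong (λ k → r ℚ.* ι (+ k)) (sym ↧r≡1)) (q*↧q≡↥q r))
  where
  eqℚ : ∀ t → ι (+ M) ℚ.* ι (↥ r ℤ.^ t) ≡ ι (proj₁ (h t)) ℚ.* ι (↧ r ℤ.^ t)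
  eqℚ t = begin
    ι (+ M) ℚ.* ι (↥ r ℤ.^ t)                            ≡⟨ cong (ι (+ M) ℚ.*_) (ι-^ (↥ r) t) ⟨
    ι (+ M) ℚ.* (ι (↥ r) ℚExp.^ t)                       ≡⟨ cong (λ x → ι (+ M) ℚ.* (x ℚExp.^ t)) (q*↧q≡↥q r) ⟨
    ι (+ M) ℚ.* ((r ℚ.* ι (↧ r)) ℚExp.^ t)               ≡⟨ cong (ι (+ M) ℚ.*_) (*-^ r (ι (↧ r)) t) ⟩
    ι (+ M) ℚ.* ((r ℚExp.^ t) ℚ.* (ι (↧ r) ℚExp.^ t))    ≡⟨ ℚ.*-assoc (ι (+ M)) (r ℚExp.^ t) (ι (↧ r) ℚExp.^ t) ⟨
    (ι (+ M) ℚ.* (r ℚExp.^ t)) ℚ.* (ι (↧ r) ℚExp.^ t)    ≡⟨ cong₂ ℚ._*_ (proj₂ (h t)) (ι-^ (↧ r) t) ⟩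
    ι (proj₁ (h t)) ℚ.* ι (↧ r ℤ.^ t)                    ∎
    where open ≡-Reasoning

  eqℤ : ∀ t → + M ℤ.* (↥ r ℤ.^ t) ≡ proj₁ (h t) ℤ.* (↧ r ℤ.^ t)
  eqℤ t = ι-injective (trans (sym (ι-* (+ M) (↥ r ℤ.^ t)))
    (trans (eqℚ t) (ι-* (proj₁ (h t)) (↧ r ℤ.^ t))))

  eqℕ : ∀ t → ℤ.∣ ↥ r ∣ ℕ.^ t ℕ.* M ≡ ℤ.∣ proj₁ (h t) ∣ ℕ.* ↧ₙ r ℕ.^ t
  eqℕ t = begin
    ℤ.∣ ↥ r ∣ ℕ.^ t ℕ.* M                   ≡⟨ ℕ.*-comm (ℤ.∣ ↥ r ∣ ℕ.^ t) M ⟩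
    M ℕ.* ℤ.∣ ↥ r ∣ ℕ.^ t                   ≡⟨ cong (M ℕ.*_) (abs-^ (↥ r) t) ⟨
    M ℕ.* ℤ.∣ ↥ r ℤ.^ t ∣                   ≡⟨ ℤ.abs-* (+ M) (↥ r ℤ.^ t) ⟨
    ℤ.∣ + M ℤ.* (↥ r ℤ.^ t) ∣               ≡⟨ cong ℤ.∣_∣ (eqℤ t) ⟩
    ℤ.∣ proj₁ (h t) ℤ.* (↧ r ℤ.^ t) ∣       ≡⟨ ℤ.abs-* (proj₁ (h t)) (↧ r ℤ.^ t) ⟩
    ℤ.∣ proj₁ (h t) ∣ ℕ.* ℤ.∣ ↧ r ℤ.^ t ∣   ≡⟨ cong (ℤ.∣ proj₁ (h t) ∣ ℕ.*_) (abs-^ (↧ r) t) ⟩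
    ℤ.∣ proj₁ (h t) ∣ ℕ.* ↧ₙ r ℕ.^ t        ∎
    where open ≡-Reasoning

  ↧r≡1 : ↧ₙ r ≡ 1
  ↧r≡1 = powers-bounded M (s≤s z≤n)
    (↧-coprime-↥ r)
    (λ t → ℕ∣.divides ℤ.∣ proj₁ (h t) ∣ (eqℕ t))

module Integrality (K : RealQuadraticField) where

  open QuadraticField K
  open ℚ.+-*-Solver using (solve; _:=_; con)
    renaming (_:+_ to _⊕_; _:*_ to _⊗_; :-_ to ⊖_; _:-_ to _⊝_)
  private module R = CommutativeRing commutativeRing

  norm-formula : ∀ x → norm x ≡ re x ℚ.* re x ℚ.- D ℚ.* (im x ℚ.* im x)
  norm-formula x = solve 3 (λ e a b →
      (a ⊗ con 1ℚ ⊕ e ⊗ (b ⊗ con 0ℚ)) ⊗ (a ⊗ con 1ℚ ⊕ b ⊗ con 0ℚ)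
      ⊝ (a ⊗ con 0ℚ ⊕ e ⊗ (b ⊗ con 1ℚ)) ⊗ (a ⊗ con 0ℚ ⊕ b ⊗ con 1ℚ)
      := a ⊗ a ⊝ e ⊗ (b ⊗ b)) refl
    D (re x) (im x)

  norm-* : ∀ x y → norm (x * y) ≡ norm x ℚ.* norm y
  norm-* x y = begin
    norm (x * y)       ≡⟨ norm-formula (x * y) ⟩
    re (x * y) ℚ.* re (x * y) ℚ.- D ℚ.* (im (x * y) ℚ.* im (x * y))
      ≡⟨ solve 5 (λ e a b p q →
           (a ⊗ p ⊕ e ⊗ (b ⊗ q)) ⊗ (a ⊗ p ⊕ e ⊗ (b ⊗ q))
           ⊝ e ⊗ ((a ⊗ q ⊕ b ⊗ p) ⊗ (a ⊗ q ⊕ b ⊗ p))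
           := (a ⊗ a ⊝ e ⊗ (b ⊗ b)) ⊗ (p ⊗ p ⊝ e ⊗ (q ⊗ q))) refl
         D (re x) (im x) (re y) (im y) ⟩
    (re x ℚ.* re x ℚ.- D ℚ.* (im x ℚ.* im x)) ℚ.*
    (re y ℚ.* re y ℚ.- D ℚ.* (im y ℚ.* im y))
      ≡⟨ cong₂ ℚ._*_ (norm-formula x) (norm-formula y) ⟨
    norm x ℚ.* norm y  ∎
    where open ≡-Reasoning

  norm-1 : norm 1# ≡ 1ℚ
  norm-1 = trans (norm-formula 1#)
    (solve 1 (λ e → con 1ℚ ⊗ con 1ℚ ⊝ e ⊗ (con 0ℚ ⊗ con 0ℚ) := con 1ℚ) refl D)

  norm-^ : ∀ x t → norm (x ^ t) ≡ norm x ℚExp.^ t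
  norm-^ x zero    = norm-1
  norm-^ x (suc t) = trans (norm-* x (x ^ t)) (cong (norm x ℚ.*_) (norm-^ x t))

  -- L M is the lattice (1/M)ℤ[√d].

  record L (M : ℕ) (x : Carrier) : Set where
    constructor lat
    field
      re-int : IsInt (ι (+ M) ℚ.* re x)
      im-int : IsInt (ι (+ M) ℚ.* im x)

  L-+ : ∀ {M x y} → L M x → L M y → L M (x + y)
  L-+ {M} {x} {y} (lat a b) (lat p q) = lat
    (subst IsInt (sym (ℚ.*-distribˡ-+ (ι (+ M)) (re x) (re y))) (int-+ a p))
    (subst IsInt (sym (ℚ.*-distribˡ-+ (ι (+ M)) (im x) (im y))) (int-+ b q))

  L-neg : ∀ {M x} → L M x → L M (- x)
  L-neg {M} {x} (lat a b) = lat
    (subst IsInt (ℚ.neg-distribʳ-* (ι (+ M)) (re x)) (int-neg a))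
    (subst IsInt (ℚ.neg-distribʳ-* (ι (+ M)) (im x)) (int-neg b))

  L-0 : ∀ {M} → L M 0#
  L-0 {M} = lat (0ℤ , ℚ.*-zeroʳ (ι (+ M))) (0ℤ , ℚ.*-zeroʳ (ι (+ M)))

  L-scale : ∀ {M x} z → L M x → L M (fromℤ z * x)
  L-scale {M} {x} z (lat a b) = lat
    (subst IsInt (solve 5 (λ e m c a b → c ⊗ (m ⊗ a)
          := m ⊗ (c ⊗ a ⊕ e ⊗ (con 0ℚ ⊗ b))) refl
        D (ι (+ M)) (ι z) (re x) (im x)) (int-* (z , refl) a))
    (subst IsInt (solve 4 (λ m c a b → c ⊗ (m ⊗ b)
          := m ⊗ (c ⊗ b ⊕ con 0ℚ ⊗ a)) refl
        (ι (+ M)) (ι z) (re x) (im x)) (int-* (z , refl) b))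

  L-sum : ∀ {M k} (f : Fin k → Carrier) → (∀ i → L M (f i)) → L M (sum f)
  L-sum {M} {zero}  f h = L-0
  L-sum {M} {suc k} f h = L-+ (h Fin.zero) (L-sum (λ i → f (Fin.suc i)) (λ i → h (Fin.suc i)))

  L-multiple : ∀ {M} N {x} → L M x → L (N ℕ.* M) x
  L-multiple {M} N {x} (lat a b) = lat (go (re x) a) (go (im x) b)
    where
    go : ∀ q → IsInt (ι (+ M) ℚ.* q) → IsInt (ι (+ (N ℕ.* M)) ℚ.* q)
    go q h = subst IsInt
      (trans (sym (ℚ.*-assoc (ι (+ N)) (ι (+ M)) q))
        (cong (ℚ._* q) (trans (ι-* (+ N) (+ M)) (cong ι (sym (ℤ.pos-* N M))))))
      (int-* (+ N , refl) h)

  denominator : ∀ x → ∃ λ M → ℕ.NonZero M × L M x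
  denominator (a@record{} +√d b@record{}) = ↧ₙ a ℕ.* ↧ₙ b , ℕ.m*n≢0 (↧ₙ a) (↧ₙ b)
    , lat (subst (λ M → IsInt (ι (+ M) ℚ.* a)) (ℕ.*-comm (↧ₙ b) (↧ₙ a)) (go (↧ₙ b) a))
          (go (↧ₙ a) b)
    where
    go : ∀ N q → IsInt (ι (+ (N ℕ.* ↧ₙ q)) ℚ.* q)
    go N q = subst IsInt
      (trans (cong (ι (+ N) ℚ.*_) (trans (sym (q*↧q≡↥q q)) (ℚ.*-comm q (ι (↧ q)))))
        (trans (sym (ℚ.*-assoc (ι (+ N)) (ι (↧ q)) q))
          (cong (ℚ._* q) (trans (ι-* (+ N) (↧ q)) (cong ι (sym (ℤ.pos-* N (↧ₙ q))))))))
      (int-* (+ N , refl) (↥ q , refl))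

  common-denominator : ∀ k (f : Fin k → Carrier) →
    ∃ λ M → ℕ.NonZero M × (∀ i → L M (f i))
  common-denominator zero    f = 1 , _ , λ ()
  common-denominator (suc k) f with
    denominator (f Fin.zero) | common-denominator k (λ i → f (Fin.suc i))
  ... | M , M≢0 , h | N , N≢0 , g = N ℕ.* M , ℕ.m*n≢0 N M {{N≢0}} {{M≢0}} , λ where
    Fin.zero    → L-multiple N h
    (Fin.suc i) → subst (λ P → L P (f (Fin.suc i))) (ℕ.*-comm M N) (L-multiple M (g i))

  private
    module RP = RingP R.ring
    module SP = SSum R.semiring

  powers-in-lattice : ∀ x → IsIntegral x → ∃ λ M → ℕ.NonZero M × (∀ j → L M (x ^ j))
  powers-in-lattice x (k , c , root) = M , proj₁ (proj₂ cd) , <-rec (λ j → L M (x ^ j)) step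
    where
    cd = common-denominator k (λ i → x ^ toℕ i)
    M = proj₁ cd

    S : Carrier
    S = sum (λ i → fromℤ (c i) * x ^ toℕ i)

    reduce : ∀ t → x ^ (t ℕ.+ k) ≡ - sum (λ i → fromℤ (c i) * x ^ (t ℕ.+ toℕ i))
    reduce t = begin
      x ^ (t ℕ.+ k)        ≡⟨ Exp.^-homo-* semiring x t k ⟩
      x ^ t * x ^ k        ≡⟨ cong (x ^ t *_) (RP.+-inverseˡ-unique (x ^ k) S root) ⟩
      x ^ t * (- S)        ≡⟨ RP.-‿distribʳ-* (x ^ t) S ⟨
      - (x ^ t * S)        ≡⟨ cong (λ y → - y) (SP.*-distribˡ-sum (x ^ t) (λ i → fromℤ (c i) * x ^ toℕ i)) ⟩
      - sum (λ i → x ^ t * (fromℤ (c i) * x ^ toℕ i))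
        ≡⟨ cong (λ y → - y) (SP.sum-cong-≗ λ i → trans (sym (R.*-assoc (x ^ t) (fromℤ (c i)) (x ^ toℕ i)))
             (trans (cong (_* x ^ toℕ i) (R.*-comm (x ^ t) (fromℤ (c i))))
             (trans (R.*-assoc (fromℤ (c i)) (x ^ t) (x ^ toℕ i))
               (cong (fromℤ (c i) *_) (sym (Exp.^-homo-* semiring x t (toℕ i))))))) ⟩
      - sum (λ i → fromℤ (c i) * x ^ (t ℕ.+ toℕ i)) ∎
      where open ≡-Reasoning

    step : ∀ j → (∀ {i} → i ℕ.< j → L M (x ^ i)) → L M (x ^ j)
    step j ih with j ℕ.<? k
    ... | yes j<k = subst (λ i → L M (x ^ i)) (Fin.toℕ-fromℕ< j<k)
                      (proj₂ (proj₂ cd) (Fin.fromℕ< j<k))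
    ... | no j≮k = subst (L M) (trans (sym (reduce t)) (cong (x ^_) t+k≡j))
        (L-neg (L-sum _ λ i → L-scale (c i) (ih
          (ℕ.<-≤-trans (ℕ.+-monoʳ-< t (Fin.toℕ<n i)) (ℕ.≤-reflexive t+k≡j)))))
      where
      t = j ℕ.∸ k
      t+k≡j : t ℕ.+ k ≡ j
      t+k≡j = ℕ.m∸n+n≡m (ℕ.≮⇒≥ j≮k)

  lattice-norm : ∀ M x → L M x → IsInt (ι (+ (M ℕ.* M)) ℚ.* norm x)
  lattice-norm M x (lat a b) = subst IsInt eq
      (int-+ (int-* a a) (int-neg (int-* (+ RealQuadraticField.d K , refl) (int-* b b))))
    where
    m = ι (+ M)
    open ≡-Reasoning
    eq = begin
      (m ℚ.* re x) ℚ.* (m ℚ.* re x) ℚ.- D ℚ.* ((m ℚ.* im x) ℚ.* (m ℚ.* im x))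
        ≡⟨ solve 4 (λ e m a b →
             (m ⊗ a) ⊗ (m ⊗ a) ⊝ e ⊗ ((m ⊗ b) ⊗ (m ⊗ b))
             := (m ⊗ m) ⊗ (a ⊗ a ⊝ e ⊗ (b ⊗ b))) refl D m (re x) (im x) ⟩
      (m ℚ.* m) ℚ.* (re x ℚ.* re x ℚ.- D ℚ.* (im x ℚ.* im x))
        ≡⟨ cong₂ ℚ._*_ (trans (ι-* (+ M) (+ M)) (cong ι (sym (ℤ.pos-* M M)))) (sym (norm-formula x)) ⟩
      ι (+ (M ℕ.* M)) ℚ.* norm x ∎

  norm-int : ∀ x → IsIntegral x → ∀ n → IsInt (norm (x ^ n - 1#))
  norm-int x x∈𝓞 n = bounded-denominators⇒int (M ℕ.* M) {{ℕ.m*n≢0 M M {{M≢0}} {{M≢0}}}} (norm y)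
      (λ t → subst (λ r → IsInt (ι (+ (M ℕ.* M)) ℚ.* r)) (norm-^ y t)
        (lattice-norm M (y ^ t) (subst (L M) (R.*-identityʳ (y ^ t)) (y^t*x^j t 0))))
    where
    pl = powers-in-lattice x x∈𝓞
    M = proj₁ pl
    M≢0 = proj₁ (proj₂ pl)

    y : Carrier
    y = x ^ n - 1#

    y^t*x^j : ∀ t j → L M (y ^ t * x ^ j)
    y^t*x^j zero    j = subst (L M) (sym (R.*-identityˡ (x ^ j))) (proj₂ (proj₂ pl) j)
    y^t*x^j (suc t) j = subst (L M) eq (L-+ (y^t*x^j t (n ℕ.+ j)) (L-neg (y^t*x^j t j)))
      where
      open ≡-Reasoning
      eq : y ^ t * x ^ (n ℕ.+ j) - y ^ t * x ^ j ≡ y * y ^ t * x ^ j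
      eq = begin
        y ^ t * x ^ (n ℕ.+ j) - y ^ t * x ^ j
          ≡⟨ cong (λ z → y ^ t * z - y ^ t * x ^ j) (Exp.^-homo-* semiring x n j) ⟩
        y ^ t * (x ^ n * x ^ j) - y ^ t * x ^ j
          ≡⟨ RP.x[y-z]≈xy-xz (y ^ t) (x ^ n * x ^ j) (x ^ j) ⟨
        y ^ t * (x ^ n * x ^ j - x ^ j)
          ≡⟨ cong (λ z → y ^ t * (x ^ n * x ^ j - z)) (R.*-identityˡ (x ^ j)) ⟨
        y ^ t * (x ^ n * x ^ j - 1# * x ^ j)
          ≡⟨ cong (y ^ t *_) (RP.[y-z]x≈yx-zx (x ^ j) (x ^ n) 1#) ⟨
        y ^ t * (y * x ^ j)
          ≡⟨ R.*-assoc (y ^ t) y (x ^ j) ⟨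
        y ^ t * y * x ^ j
          ≡⟨ cong (_* x ^ j) (R.*-comm (y ^ t) y) ⟩
        y * y ^ t * x ^ j ∎

  Δ-norm : ∀ α n → ι (Δ α n) ≡ norm (⟦ α ⟧ ^ n - 1#)
  Δ-norm α n = ι-↥ (norm-int ⟦ α ⟧ (proj₂ α) n)

  square-root-int : ∀ r z → r ℚ.* r ≡ ι z → IsInt r
  square-root-int r z r²≡z = bounded-denominators⇒int (↧ₙ r) r bounded
    where
    bounded : ∀ t → IsInt (ι (↧ r) ℚ.* (r ℚExp.^ t))
    bounded zero          = ↧ r , ℚ.*-identityʳ (ι (↧ r))
    bounded (suc zero)    = ↥ r , trans (cong (ι (↧ r) ℚ.*_) (ℚ.*-identityʳ r))
                              (trans (ℚ.*-comm (ι (↧ r)) r) (q*↧q≡↥q r))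
    bounded (suc (suc t)) = subst IsInt
      (solve 3 (λ m r s → (m ⊗ s) ⊗ (r ⊗ r) := m ⊗ (r ⊗ (r ⊗ s))) refl
        (ι (↧ r)) r (r ℚExp.^ t))
      (int-* (bounded t) (z , r²≡z))

  private
    -- Stated for arbitrary rationals so that Agda does not unfold reciprocals.

    reciprocal : ∀ q → q ≢ 0ℚ → ∃ λ s → q ℚ.* s ≡ 1ℚ
    reciprocal q q≢0 = (ℚ.1/ q) , ℚ.*-inverseʳ q
      where instance _ = ℚ.≢-nonZero q≢0

    square≡0 : ∀ a → a ℚ.* a ≡ 0ℚ → a ≡ 0ℚ
    square≡0 a a²≡0 with a ℚ.≟ 0ℚ
    ... | yes a≡0 = a≡0
    ... | no a≢0 with reciprocal a a≢0
    ...   | s , as≡1 = trans (sym (ℚ.*-identityʳ a)) (trans (cong (a ℚ.*_) (sym as≡1))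
              (trans (sym (ℚ.*-assoc a a s)) (trans (cong (ℚ._* s) a²≡0) (ℚ.*-zeroˡ s))))

    D-not-square : ∀ r → r ℚ.* r ≢ D
    D-not-square r r²≡D = go (square-root-int r (+ RealQuadraticField.d K) r²≡D)
      where
      z² : ∀ z → r ≡ ι z → ι (z ℤ.* z) ≡ ι (+ RealQuadraticField.d K)
      z² z r≡z = trans (sym (ι-* z z)) (trans (sym (cong₂ ℚ._*_ r≡z r≡z)) r²≡D)

      go : ¬ IsInt r
      go (z , r≡z) = RealQuadraticField.nonSquare K ℤ.∣ z ∣
        (trans (sym (ℤ.abs-* z z)) (cong ℤ.∣_∣ (ι-injective {z ℤ.* z} {+ RealQuadraticField.d K} (z² z r≡z))))

    quotient-square : ∀ a b s → b ℚ.* s ≡ 1ℚ → a ℚ.* a ℚ.- D ℚ.* (b ℚ.* b) ≡ 0ℚ →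
      (a ℚ.* s) ℚ.* (a ℚ.* s) ≡ D
    quotient-square a b s bs≡1 N≡0 = trans
      (solve 4 (λ e a b s → (a ⊗ s) ⊗ (a ⊗ s)
           := (a ⊗ a ⊝ e ⊗ (b ⊗ b)) ⊗ (s ⊗ s) ⊕ e ⊗ ((b ⊗ s) ⊗ (b ⊗ s))) refl
         D a b s)
      (trans (cong₂ (λ n u → n ℚ.* (s ℚ.* s) ℚ.+ D ℚ.* (u ℚ.* u)) N≡0 bs≡1)
      (solve 2 (λ e s → con 0ℚ ⊗ (s ⊗ s) ⊕ e ⊗ (con 1ℚ ⊗ con 1ℚ) := e) refl D s))

    anisotropic : ∀ a b → a ℚ.* a ℚ.- D ℚ.* (b ℚ.* b) ≡ 0ℚ → a ≡ 0ℚ × b ≡ 0ℚ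
    anisotropic a b N≡0 with b ℚ.≟ 0ℚ
    ... | yes refl = square≡0 a (trans
            (solve 2 (λ e a → a ⊗ a := a ⊗ a ⊝ e ⊗ (con 0ℚ ⊗ con 0ℚ)) refl D a) N≡0)
          , refl
    ... | no b≢0 with reciprocal b b≢0
    ...   | s , bs≡1 = ⊥-elim (D-not-square (a ℚ.* s) (quotient-square a b s bs≡1 N≡0))

    conjugate-inverse : ∀ x v → norm x ℚ.* v ≡ 1ℚ →
      x * (re x ℚ.* v +√d (ℚ.- im x) ℚ.* v) ≡ 1#
    conjugate-inverse x v Nv≡1 = cong₂ _+√d_
      (trans (solve 4 (λ e a b v → a ⊗ (a ⊗ v) ⊕ e ⊗ (b ⊗ (⊖ b ⊗ v))
                 := (a ⊗ a ⊝ e ⊗ (b ⊗ b)) ⊗ v) refl D (re x) (im x) v)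
        (trans (cong (ℚ._* v) (sym (norm-formula x))) Nv≡1))
      (solve 3 (λ a b v → a ⊗ (⊖ b ⊗ v) ⊕ b ⊗ (a ⊗ v) := con 0ℚ) refl (re x) (im x) v)

  norm≡0⇒≡0 : ∀ x → norm x ≡ 0ℚ → x ≡ 0#
  norm≡0⇒≡0 x Nx≡0 = cong₂ _+√d_ (proj₁ ab≡0) (proj₂ ab≡0)
    where
    ab≡0 : re x ≡ 0ℚ × im x ≡ 0ℚ
    ab≡0 = anisotropic (re x) (im x) (trans (sym (norm-formula x)) Nx≡0)

  inverse : ∀ x → x ≢ 0# → ∃ λ y → x * y ≡ 1#
  inverse x x≢0 = go (reciprocal (norm x) (λ Nx≡0 → x≢0 (norm≡0⇒≡0 x Nx≡0)))
    where
    go : (∃ λ v → norm x ℚ.* v ≡ 1ℚ) → ∃ λ y → x * y ≡ 1#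
    go (v , Nv≡1) = (re x ℚ.* v +√d (ℚ.- im x) ℚ.* v) , conjugate-inverse x v Nv≡1

{-# OPTIONS --safe #-}
module Submission where

open import Defs
open import Data.Nat.Base using (ℕ; _≤_; _<_; _%_)
open import Data.Product.Base using (∃; _×_)
open import Data.Rational.Base as ℚ using (1ℚ)
open import Relation.Binary.PropositionalEquality using (_≡_; _≢_)

open import Algebra.Bundles using (CommutativeRing)
import Algebra.Properties.Ring as RingP
import Algebra.Properties.Semiring.Exp as Exp
open import Data.Empty using (⊥; ⊥-elim)
open import Data.Integer.Base as ℤ using (ℤ; +_; -[1+_]; ∣_∣; 0ℤ)
import Data.Integer.DivMod as ℤ
import Data.Integer.Divisibility.Signed as ℤ∣
import Data.Integer.Properties as ℤ
import Data.Integer.Tactic.RingSolver as ℤ-Solver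
open import Data.List.Base using (List; []; _∷_; length; map)
open import Data.List.Membership.Propositional using (_∈_)
open import Data.List.Relation.Unary.All as All using (All; []; _∷_)
open import Data.List.Relation.Unary.AllPairs using (AllPairs; []; _∷_)
open import Data.List.Relation.Unary.Any using (here; there; any?)
open import Data.Nat.Base hiding (ℕ; _≤_; _<_; _%_; parity)
open import Data.Nat.Coprimality as Coprime using (Coprime; coprime-divisor)
open import Data.Nat.Divisibility
open import Data.Nat.DivMod using (m≡m%n+[m/n]*n; m%n<n; [m+kn]%n≡m%n)
open import Data.Nat.GCD
open import Data.Nat.Induction using (<-rec)
open import Data.Nat.LCM
open import Data.Nat.ListAction using (product)
open import Data.Nat.Primality
open import Data.Nat.Primality.Factorisation using (factorise; module PrimeFactorisation)
open import Data.Nat.Properties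
open import Data.Nat.Tactic.RingSolver using (solve-∀)
open import Data.Product.Base using (_,_; proj₁; proj₂)
open import Data.Rational.Base using (ℚ; 0ℚ)
import Data.Rational.Properties as ℚ
import Data.Rational.Solver as ℚ
open import Data.Sum.Base using (_⊎_; inj₁; inj₂; reduce)
open import Function.Base using (_∘_; it)
open import Relation.Binary.PropositionalEquality
open import Relation.Nullary using (¬_; yes; no; Dec)
open import Relation.Nullary.Decidable using (map′; ¬?; _×-dec_; _→-dec_; from-yes; decidable-stable)
open import Relation.Unary using (Pred; Empty)

-- For a unit α of norm 1 and trace t, Δ n = − W n with W n = αⁿ + α⁻ⁿ − 2, and Fricke's trace
-- identity makes W a strong divisibility sequence.  Let A be the cofactor in W n of the least
-- common multiple of the W (n / q), q running through the primes dividing n (A is essentially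
-- the norm of Φₙ(α)).  If W n has no primitive prime divisor, then a prime p dividing A can
-- divide W g, for g a proper divisor of n, only if n / g is a power of p, and W n / W (n / p)
-- is exactly divisible by p² (n large); hence A divides n².  On the other hand, V m = αᵐ + α⁻ᵐ satisfies
-- ∣V m∣ ∣V n∣ ≍ ∣V (m + n)∣ up to a factor 2, so inclusion–exclusion over the prime divisors gives
-- A ≥ 2 ^ (φ(n) − 3 · 2 ^ ω(n)) whatever α is, and this exceeds n² as soon as n is large.
-- For norm −1 one passes to α²: Δ (2m) = − W m and Δ(n)² = W n for n odd, and a primitive
-- prime divisor of W (n / 2) (when 4 divides n) or of W n (n odd) is primitive for Δ n.

-- Uniformity comes from separating size from arithmetic. The lower bound for A uses only
-- `3 ≤ ∣ t ∣`, which holds because t² - 4 is nonnegative in a real field and t = ±2 forces α = ±1;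
-- the upper bound n² does not involve t. Hence the constants depend neither on α nor on K. The
-- exponent 2 reflects W n = (α^(n/2) - α^(-n/2))²: the relevant quotients W (p j) / W j are squares
-- s², and s is p modulo p². The primes 2 and 3 are the obstacle, since for them p ∣ W j does not
-- determine s modulo p². As 6 divides W 12 for every t, such a prime dividing A already divides W
-- (gcd(n, 12)); for n > 48 enough further factors p of n are then available to have p divide W (j /
-- 4) or W (j / 3), which does determine s. For norm -1 the residue 2 modulo 4 is a genuine
-- exception: for m odd, Δ (2m) = - Δ(m)², so every prime dividing Δ (2m) already divides Δ(m).

-- Gcd and lcm of natural numbers

square-∣ : ∀ d k → d * d ∣ k * k → d ∣ k
square-∣ zero k h with m*n≡0⇒m≡0∨n≡0 k (0∣⇒≡0 h)
... | inj₁ refl = ∣-refl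
... | inj₂ refl = ∣-refl
square-∣ d@(suc _) k h with gcd d k in eq | gcd[m,n]∣m d k | gcd[m,n]∣n d k
... | zero  | g∣d | _ with () ← 0∣⇒≡0 g∣d
... | g@(suc _) | divides d′ d≡ | divides k′ k≡ = subst₂ _∣_
    (trans (sym (*-identityˡ g)) (trans (cong (_* g) (sym d′≡1)) (sym d≡))) (sym k≡) (n∣m*n k′)
  where
  coprime : Coprime d′ k′
  coprime = Coprime.gcd≡1⇒coprime (*-cancelˡ-≡ _ _ g (trans (c*gcd[m,n]≡gcd[cm,cn] g d′ k′)
    (trans (cong₂ gcd (trans (*-comm g d′) (sym d≡)) (trans (*-comm g k′) (sym k≡)))
      (trans eq (sym (*-identityʳ g))))))
  factor : ∀ a b → (a * b) * (a * b) ≡ (b * b) * (a * a)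
  factor = solve-∀
  d′²∣k′² : d′ * d′ ∣ k′ * k′
  d′²∣k′² = *-cancelˡ-∣ (g * g) (subst₂ _∣_
    (trans (cong₂ _*_ d≡ d≡) (factor d′ g)) (trans (cong₂ _*_ k≡ k≡) (factor k′ g)) h)
  d′≡1 : d′ ≡ 1
  d′≡1 = coprime (∣-refl , coprime-divisor coprime (∣-trans (m∣m*n d′) d′²∣k′²))

gcd-nonZeroʳ : ∀ m n .{{_ : NonZero n}} → NonZero (gcd m n)
gcd-nonZeroʳ m n = ≢-nonZero (≢-nonZero⁻¹ n ∘ gcd[m,n]≡0⇒n≡0 m)

-- With g = gcd(a,b,c), the numbers d g and gcd(a,b) gcd(a,c) are compared: the
-- latter is g · lcm(gcd(a,b), gcd(a,c)).
gcd-distribˡ-lcm : ∀ a b c .{{_ : NonZero c}} → gcd a (lcm b c) ≡ lcm (gcd a b) (gcd a c)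
gcd-distribˡ-lcm a b c = ∣-antisym
  (*-cancelˡ-∣ g {{g≢0}} (subst (g * d ∣_) (sym (gcd*lcm (gcd a b) (gcd a c))) gd∣))
  (lcm-least
    (gcd-greatest (gcd[m,n]∣m a b) (∣-trans (gcd[m,n]∣n a b) (m∣lcm[m,n] b c)))
    (gcd-greatest (gcd[m,n]∣m a c) (∣-trans (gcd[m,n]∣n a c) (n∣lcm[m,n] b c))))
  where
  d = gcd a (lcm b c)
  g = gcd (gcd a b) (gcd a c)
  g≢0 : NonZero g
  g≢0 = gcd-nonZeroʳ (gcd a b) (gcd a c) {{gcd-nonZeroʳ a c}}
  g∣a = ∣-trans (gcd[m,n]∣m (gcd a b) (gcd a c)) (gcd[m,n]∣m a b)
  g∣b = ∣-trans (gcd[m,n]∣m (gcd a b) (gcd a c)) (gcd[m,n]∣n a b)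
  g∣c = ∣-trans (gcd[m,n]∣n (gcd a b) (gcd a c)) (gcd[m,n]∣n a c)
  d∣a = gcd[m,n]∣m a (lcm b c)
  gd∣bc : g * d ∣ b * c
  gd∣bc = subst (g * d ∣_) (gcd*lcm b c) (*-pres-∣ (gcd-greatest g∣b g∣c) (gcd[m,n]∣n a (lcm b c)))
  gd∣ab·a : g * d ∣ gcd a b * a
  gd∣ab·a = subst (g * d ∣_)
    (trans (sym (c*gcd[m,n]≡gcd[cm,cn] a a b)) (*-comm a (gcd a b)))
    (gcd-greatest (*-pres-∣ g∣a d∣a) (subst (g * d ∣_) (*-comm b a) (*-pres-∣ g∣b d∣a)))
  gd∣ab·c : g * d ∣ gcd a b * c
  gd∣ab·c = subst (g * d ∣_)
    (trans (sym (c*gcd[m,n]≡gcd[cm,cn] c a b)) (*-comm c (gcd a b)))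
    (gcd-greatest (*-pres-∣ g∣c d∣a) (subst (g * d ∣_) (*-comm b c) gd∣bc))
  gd∣ : g * d ∣ gcd a b * gcd a c
  gd∣ = subst (g * d ∣_) (sym (c*gcd[m,n]≡gcd[cm,cn] (gcd a b) a c)) (gcd-greatest gd∣ab·a gd∣ab·c)

-- Cyclotomic cofactors of a strong divisibility sequence

product-swap : ∀ x y z → x * y * z ≡ x * z * y
product-swap = solve-∀

-- For a strong divisibility sequence w and N = m q₁ ⋯ qₖ, `old m qs` is the least
-- common multiple of the w (N / qᵢ); its cofactor in w N plays the role of the
-- value of the N-th cyclotomic polynomial, without any Möbius inversion.
module StrongDivisibility (w : ℕ → ℕ) (w≢0 : ∀ n .{{_ : NonZero n}} → NonZero (w n))
  (w-gcd : ∀ m n → gcd (w m) (w n) ≡ w (gcd m n)) where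

  w-∣ : ∀ {m n} → m ∣ n → w m ∣ w n
  w-∣ {m} {n} m∣n = subst (_∣ w n)
    (trans (w-gcd m n) (cong w (∣-antisym (gcd[m,n]∣m m n) (gcd-greatest ∣-refl m∣n))))
    (gcd[m,n]∣n (w m) (w n))

  -- The head `q` contributes the index N / q; the tail absorbs `q` into `m`, which keeps N fixed
  -- without any division.
  old : ℕ → List ℕ → ℕ
  old m []       = 1
  old m (q ∷ qs) = lcm (w (m * product qs)) (old (m * q) qs)

  old-∣ : ∀ m qs → old m qs ∣ w (m * product qs)
  old-∣ m []       = 1∣ _
  old-∣ m (q ∷ qs) = lcm-least
    (w-∣ (subst (m * product qs ∣_) (trans (product-swap m (product qs) q) (*-assoc m q _)) (m∣m*n q)))
    (subst (λ k → old (m * q) qs ∣ w k) (*-assoc m q (product qs)) (old-∣ (m * q) qs))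

  ∣-old : ∀ m qs {q k} → .{{NonZero q}} → q ∈ qs → k * q ≡ m * product qs → w k ∣ old m qs
  ∣-old m (q ∷ qs) {k = k} (here refl) eq = subst (λ j → w j ∣ lcm (w (m * product qs)) (old (m * q) qs))
    (*-cancelʳ-≡ _ _ q (trans (product-swap m (product qs) q) (trans (*-assoc m q (product qs)) (sym eq))))
    (m∣lcm[m,n] (w (m * product qs)) (old (m * q) qs))
  ∣-old m (r ∷ qs) (there q∈qs) eq = ∣-trans
    (∣-old (m * r) qs q∈qs (trans eq (sym (*-assoc m r (product qs)))))
    (n∣lcm[m,n] (w (m * product qs)) (old (m * r) qs))

  new : ℕ → List ℕ → ℕ
  new m qs = quotient (old-∣ m qs)

  new*old : ∀ m qs → new m qs * old m qs ≡ w (m * product qs)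
  new*old m qs = sym (_∣_.equality (old-∣ m qs))

  module _ {m : ℕ} .{{_ : NonZero m}} {qs : List ℕ} (qs≢0 : All NonZero qs) where

    product-nonZero : NonZero (m * product qs)
    product-nonZero = go m qs≢0
      where
      go : ∀ k .{{_ : NonZero k}} {rs} → All NonZero rs → NonZero (k * product rs)
      go k [] = m*n≢0 k 1
      go k {r ∷ rs} (r≢0 ∷ h) = subst NonZero (*-assoc k r (product rs))
        (go (k * r) {{m*n≢0 k r {{it}} {{r≢0}}}} h)

    new*old≢0 : NonZero (new m qs * old m qs)
    new*old≢0 = subst NonZero (sym (new*old m qs)) (w≢0 (m * product qs) {{product-nonZero}})

    new≢0 : NonZero (new m qs)
    new≢0 = m*n≢0⇒m≢0 (new m qs) {{new*old≢0}}

    old≢0 : NonZero (old m qs)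
    old≢0 = m*n≢0⇒n≢0 (new m qs) {{new*old≢0}}

  -- With P the product of `qs`, an index of `old (m * r) qs` is r (m P / q), and its gcd with m P
  -- is m P / q because r is coprime to q. Distributivity of gcd over lcm assembles these.
  gcd-old : ∀ m .{{_ : NonZero m}} r .{{_ : NonZero r}} {qs} → All NonZero qs → All (Coprime r) qs →
    gcd (w (m * product qs)) (old (m * r) qs) ≡ old m qs
  gcd-old m r [] [] = gcd-zeroʳ (w (m * 1))
  gcd-old m r {q ∷ qs} (q≢0 ∷ qs≢0) (r⊥q ∷ r⊥qs) = begin
    gcd (w (m * (q * P))) (lcm (w (m * r * P)) (old (m * r * q) qs))
      ≡⟨ gcd-distribˡ-lcm (w (m * (q * P))) (w (m * r * P)) (old (m * r * q) qs) {{old≢0 {{mrq≢0}} qs≢0}} ⟩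
    lcm (gcd (w (m * (q * P))) (w (m * r * P))) (gcd (w (m * (q * P))) (old (m * r * q) qs))
      ≡⟨ cong₂ lcm (trans (w-gcd (m * (q * P)) (m * r * P)) (cong w gcd-indices))
           (trans (cong₂ (λ i j → gcd (w i) (old j qs)) (sym (*-assoc m q P)) (product-swap m r q))
             (gcd-old (m * q) {{mq≢0}} r qs≢0 r⊥qs)) ⟩
    lcm (w (m * P)) (old (m * q) qs) ∎
    where
    open ≡-Reasoning
    P = product qs
    mq≢0 : NonZero (m * q)
    mq≢0 = m*n≢0 m q {{it}} {{q≢0}}
    mrq≢0 : NonZero (m * r * q)
    mrq≢0 = m*n≢0 (m * r) q {{m*n≢0 m r}} {{q≢0}}
    perm₁ : ∀ m q P → m * (q * P) ≡ m * P * q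
    perm₁ = solve-∀
    gcd-indices : gcd (m * (q * P)) (m * r * P) ≡ m * P
    gcd-indices = begin
      gcd (m * (q * P)) (m * r * P)   ≡⟨ cong₂ gcd (perm₁ m q P) (product-swap m r P) ⟩
      gcd (m * P * q) (m * P * r)     ≡⟨ c*gcd[m,n]≡gcd[cm,cn] (m * P) q r ⟨
      m * P * gcd q r                 ≡⟨ cong (m * P *_) (Coprime.coprime⇒gcd≡1 (Coprime.sym r⊥q)) ⟩
      m * P * 1                       ≡⟨ *-identityʳ (m * P) ⟩
      m * P ∎

  -- In cyclotomic terms the divisors d counted by `new (m * q) qs` split according to whether d
  -- divides N / q. The proof is gcd · lcm = product, `gcd-old` giving the gcd of the two entries of
  -- the lcm `old m (q ∷ qs)`.
  new-∷ : ∀ m .{{_ : NonZero m}} q .{{_ : NonZero q}} {qs} → All NonZero qs → All (Coprime q) qs →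
    new m (q ∷ qs) * new m qs ≡ new (m * q) qs
  new-∷ m q {qs} qs≢0 q⊥qs = *-cancelʳ-≡ _ _ (old m (q ∷ qs) * old m qs)
    {{m*n≢0 _ _ {{old≢0 (q≢0 ∷ qs≢0)}} {{old≢0 qs≢0}}}} (begin
    new m (q ∷ qs) * new m qs * (old m (q ∷ qs) * old m qs)
      ≡⟨ rearrange (new m (q ∷ qs)) (new m qs) (old m (q ∷ qs)) (old m qs) ⟩
    new m (q ∷ qs) * old m (q ∷ qs) * (new m qs * old m qs)
      ≡⟨ cong₂ _*_ (trans (new*old m (q ∷ qs))
                     (trans (cong w (sym (*-assoc m q (product qs)))) (sym (new*old (m * q) qs))))
                   (new*old m qs) ⟩
    new (m * q) qs * old (m * q) qs * w (m * product qs)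
      ≡⟨ *-assoc (new (m * q) qs) (old (m * q) qs) (w (m * product qs)) ⟩
    new (m * q) qs * (old (m * q) qs * w (m * product qs))
      ≡⟨ cong (new (m * q) qs *_) (trans (*-comm (old (m * q) qs) (w (m * product qs)))
           (trans (sym (gcd*lcm (w (m * product qs)) (old (m * q) qs)))
           (trans (cong (_* old m (q ∷ qs)) (gcd-old m q qs≢0 q⊥qs)) (*-comm (old m qs) (old m (q ∷ qs)))))) ⟩
    new (m * q) qs * (old m (q ∷ qs) * old m qs) ∎)
    where
    open ≡-Reasoning
    q≢0 : NonZero q
    q≢0 = ≢-nonZero (≢-nonZero⁻¹ q)
    rearrange : ∀ a b c d → a * b * (c * d) ≡ a * c * (b * d)
    rearrange = solve-∀

  -- Since `w k` divides `old m qs`, it cancels from `new m qs * w k ∣ w N`. This replaces the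
  -- implicit cofactor by an explicit quotient.
  new-∣-quotient : ∀ m .{{_ : NonZero m}} {qs} → All NonZero qs → ∀ {q k R} .{{_ : NonZero q}} →
    q ∈ qs → k * q ≡ m * product qs →
    w (m * product qs) ≡ w k * R → new m qs ∣ R
  new-∣-quotient m {qs} qs≢0 {q} {k} {R} q∈qs eq wN = *-cancelˡ-∣ (w k) {{w≢0 k {{k≢0}}}} (subst₂ _∣_
      (*-comm (new m qs) (w k)) (trans (new*old m qs) wN) (*-monoʳ-∣ (new m qs) (∣-old m qs q∈qs eq)))
    where
    k≢0 : NonZero k
    k≢0 = m*n≢0⇒m≢0 k {{subst NonZero (sym eq) (product-nonZero qs≢0)}}

-- Traces of powers of a norm-one unit and strong divisibility of W

V : ℤ → ℕ → ℤ
V t 0             = + 2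
V t 1             = t
V t (suc (suc n)) = t ℤ.* V t (suc n) ℤ.- V t n

W : ℤ → ℕ → ℤ
W t n = V t n ℤ.- + 2

-- Expansion of (αᵐ + α⁻ᵐ)(αⁿ + α⁻ⁿ), with n written as m + k so that no difference of indices
-- occurs.
V-+ : ∀ t m k → V t (m + (m + k)) ≡ V t m ℤ.* V t (m + k) ℤ.- V t k
V-+ t zero k = base (V t k)
  where
  base : ∀ x → x ≡ + 2 ℤ.* x ℤ.- x
  base = ℤ-Solver.solve-∀
V-+ t (suc zero) k = refl
V-+ t (suc (suc m)) k = begin
  t ℤ.* V t (suc m + (2 + (m + k))) ℤ.- V t (m + (2 + (m + k)))
    ≡⟨ cong₂ (λ i j → t ℤ.* V t i ℤ.- V t j) (cong (λ j → suc m + suc j) (sym (+-suc m k)))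
         (cong (λ j → m + j) (sym 2+mk)) ⟩
  t ℤ.* V t (suc m + (suc m + suc k)) ℤ.- V t (m + (m + suc (suc k)))
    ≡⟨ cong₂ (λ x y → t ℤ.* x ℤ.- y) (V-+ t (suc m) (suc k)) (V-+ t m (suc (suc k))) ⟩
  t ℤ.* (V t (suc m) ℤ.* V t (suc m + suc k) ℤ.- V t (suc k))
    ℤ.- (V t m ℤ.* V t (m + suc (suc k)) ℤ.- (t ℤ.* V t (suc k) ℤ.- V t k))
    ≡⟨ cong₂ (λ i j → t ℤ.* (V t (suc m) ℤ.* V t i ℤ.- V t (suc k))
         ℤ.- (V t m ℤ.* V t j ℤ.- (t ℤ.* V t (suc k) ℤ.- V t k)))
         (cong suc (+-suc m k)) 2+mk ⟩
  t ℤ.* (V t (suc m) ℤ.* V t (2 + (m + k)) ℤ.- V t (suc k))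
    ℤ.- (V t m ℤ.* V t (2 + (m + k)) ℤ.- (t ℤ.* V t (suc k) ℤ.- V t k))
    ≡⟨ collect t (V t (suc m)) (V t m) (V t (2 + (m + k))) (V t (suc k)) (V t k) ⟩
  (t ℤ.* V t (suc m) ℤ.- V t m) ℤ.* V t (2 + (m + k)) ℤ.- V t k ∎
  where
  open ≡-Reasoning
  2+mk : m + suc (suc k) ≡ 2 + (m + k)
  2+mk = trans (+-suc m (suc k)) (cong suc (+-suc m k))
  collect : ∀ t a b x c e → t ℤ.* (a ℤ.* x ℤ.- c) ℤ.- (b ℤ.* x ℤ.- (t ℤ.* c ℤ.- e))
    ≡ (t ℤ.* a ℤ.- b) ℤ.* x ℤ.- e
  collect = ℤ-Solver.solve-∀

-- The `V` are Dickson polynomials: αᵐ is again a unit of norm 1, now of trace `V t m`.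
V-* : ∀ t q m → V t (q * m) ≡ V (V t m) q
V-* t zero          m = refl
V-* t (suc zero)    m = cong (V t) (+-identityʳ m)
V-* t (suc (suc q)) m = trans (V-+ t m (q * m))
  (cong₂ (λ x y → V t m ℤ.* x ℤ.- y) (V-* t (suc q) m) (V-* t q m))

V-double : ∀ t m → V t (2 * m) ≡ V t m ℤ.* V t m ℤ.- + 2
V-double t m = V-* t 2 m

-- The form b² - t a b + a² is invariant under the recurrence step (a, b) ↦ (b, t b - a).
cassini : ∀ t m → V t (suc m) ℤ.* V t (suc m) ℤ.- t ℤ.* V t m ℤ.* V t (suc m) ℤ.+ V t m ℤ.* V t m
  ≡ + 4 ℤ.- t ℤ.* t
cassini t zero = base t
  where
  base : ∀ t → t ℤ.* t ℤ.- t ℤ.* + 2 ℤ.* t ℤ.+ + 4 ≡ + 4 ℤ.- t ℤ.* t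
  base = ℤ-Solver.solve-∀
cassini t (suc m) = trans (step t (V t m) (V t (suc m))) (cassini t m)
  where
  step : ∀ t a b → (t ℤ.* b ℤ.- a) ℤ.* (t ℤ.* b ℤ.- a) ℤ.- t ℤ.* b ℤ.* (t ℤ.* b ℤ.- a) ℤ.+ b ℤ.* b
    ≡ b ℤ.* b ℤ.- t ℤ.* a ℤ.* b ℤ.+ a ℤ.* a
  step = ℤ-Solver.solve-∀

-- Here αⁿ = u α - v, and the quadratic relation says that this element has norm 1.
V-shift : ∀ t n → ∃ λ u → ∃ λ v → u ℤ.* u ℤ.- t ℤ.* u ℤ.* v ℤ.+ v ℤ.* v ≡ + 1 ×
  (∀ m → V t (n + m) ≡ u ℤ.* V t (suc m) ℤ.- v ℤ.* V t m)
V-shift t zero = 0ℤ , ℤ.- + 1 , norm t , λ m → sym (base (V t (suc m)) (V t m))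
  where
  base : ∀ b a → 0ℤ ℤ.* b ℤ.- (ℤ.- + 1) ℤ.* a ≡ a
  base = ℤ-Solver.solve-∀
  norm : ∀ t → 0ℤ ℤ.* 0ℤ ℤ.- t ℤ.* 0ℤ ℤ.* (ℤ.- + 1) ℤ.+ (ℤ.- + 1) ℤ.* (ℤ.- + 1) ≡ + 1
  norm = ℤ-Solver.solve-∀
V-shift t (suc n) with V-shift t n
... | u , v , norm≡1 , shift = t ℤ.* u ℤ.- v , u , trans (norm t u v) norm≡1 , λ m →
  trans (cong (V t) (sym (+-suc n m))) (trans (shift (suc m)) (step t u v (V t (suc m)) (V t m)))
  where
  norm : ∀ t u v → (t ℤ.* u ℤ.- v) ℤ.* (t ℤ.* u ℤ.- v) ℤ.- t ℤ.* (t ℤ.* u ℤ.- v) ℤ.* u ℤ.+ u ℤ.* u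
    ≡ u ℤ.* u ℤ.- t ℤ.* u ℤ.* v ℤ.+ v ℤ.* v
  norm = ℤ-Solver.solve-∀
  step : ∀ t u v b a → u ℤ.* (t ℤ.* b ℤ.- a) ℤ.- v ℤ.* b ≡ (t ℤ.* u ℤ.- v) ℤ.* b ℤ.- u ℤ.* a
  step = ℤ-Solver.solve-∀

-- Expanded, this is x² + y² + z² - 2xy - 2yz - 2zx = xyz, symmetric in the three variables. The
-- form chosen isolates a square, from which divisibility can be read off.
Markov : ℤ → ℤ → ℤ → Set
Markov x y z = (z ℤ.- x ℤ.- y) ℤ.* (z ℤ.- x ℤ.- y) ≡ x ℤ.* y ℤ.* (z ℤ.+ + 4)

-- Fricke's trace identity.
W-markov : ∀ t m n → Markov (W t m) (W t n) (W t (n + m))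
W-markov t m n with V-shift t n
... | u , v , norm≡1 , shift = begin
  (W t (n + m) ℤ.- W t m ℤ.- W t n) ℤ.* (W t (n + m) ℤ.- W t m ℤ.- W t n)
    ≡⟨ cong₂ (λ x y → let e = (x ℤ.- + 2) ℤ.- W t m ℤ.- (y ℤ.- + 2) in e ℤ.* e) (shift m) Vn ⟩
  (let e = (u ℤ.* B ℤ.- v ℤ.* A ℤ.- + 2) ℤ.- (A ℤ.- + 2) ℤ.- (u ℤ.* t ℤ.- v ℤ.* + 2 ℤ.- + 2) in e ℤ.* e)
    -- The identity holds up to a combination of the Cassini relation and the norm relation for `u`
    -- and `v`, both of which vanish.
    ≡⟨ fricke t A B u v ⟩
  (A ℤ.- + 2) ℤ.* (u ℤ.* t ℤ.- v ℤ.* + 2 ℤ.- + 2) ℤ.* (u ℤ.* B ℤ.- v ℤ.* A ℤ.- + 2 ℤ.+ + 4)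
    ℤ.+ (u ℤ.* u ℤ.* ((B ℤ.* B ℤ.- t ℤ.* A ℤ.* B ℤ.+ A ℤ.* A) ℤ.- (+ 4 ℤ.- t ℤ.* t))
         ℤ.- (A ℤ.* A ℤ.- + 4) ℤ.* ((u ℤ.* u ℤ.- t ℤ.* u ℤ.* v ℤ.+ v ℤ.* v) ℤ.- + 1))
    ≡⟨ cong₂ (λ x y → (A ℤ.- + 2) ℤ.* (u ℤ.* t ℤ.- v ℤ.* + 2 ℤ.- + 2) ℤ.* (u ℤ.* B ℤ.- v ℤ.* A ℤ.- + 2 ℤ.+ + 4)
         ℤ.+ (u ℤ.* u ℤ.* x ℤ.- (A ℤ.* A ℤ.- + 4) ℤ.* y))
         (ℤ.i≡j⇒i-j≡0 (cassini t m)) (ℤ.i≡j⇒i-j≡0 norm≡1) ⟩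
  (A ℤ.- + 2) ℤ.* (u ℤ.* t ℤ.- v ℤ.* + 2 ℤ.- + 2) ℤ.* (u ℤ.* B ℤ.- v ℤ.* A ℤ.- + 2 ℤ.+ + 4)
    ℤ.+ (u ℤ.* u ℤ.* 0ℤ ℤ.- (A ℤ.* A ℤ.- + 4) ℤ.* 0ℤ)
    ≡⟨ drop _ (u ℤ.* u) (A ℤ.* A ℤ.- + 4) ⟩
  (A ℤ.- + 2) ℤ.* (u ℤ.* t ℤ.- v ℤ.* + 2 ℤ.- + 2) ℤ.* (u ℤ.* B ℤ.- v ℤ.* A ℤ.- + 2 ℤ.+ + 4)
    ≡⟨ cong₂ (λ x y → W t m ℤ.* (y ℤ.- + 2) ℤ.* (x ℤ.- + 2 ℤ.+ + 4)) (shift m) Vn ⟨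
  W t m ℤ.* W t n ℤ.* (W t (n + m) ℤ.+ + 4) ∎
  where
  open ≡-Reasoning
  A = V t m
  B = V t (suc m)
  Vn : V t n ≡ u ℤ.* t ℤ.- v ℤ.* + 2
  Vn = trans (cong (V t) (sym (+-identityʳ n))) (shift 0)
  drop : ∀ x a b → x ℤ.+ (a ℤ.* 0ℤ ℤ.- b ℤ.* 0ℤ) ≡ x
  drop = ℤ-Solver.solve-∀
  fricke : ∀ t A B u v →
    ((u ℤ.* B ℤ.- v ℤ.* A ℤ.- + 2) ℤ.- (A ℤ.- + 2) ℤ.- (u ℤ.* t ℤ.- v ℤ.* + 2 ℤ.- + 2)) ℤ.*
    ((u ℤ.* B ℤ.- v ℤ.* A ℤ.- + 2) ℤ.- (A ℤ.- + 2) ℤ.- (u ℤ.* t ℤ.- v ℤ.* + 2 ℤ.- + 2)) ≡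
    (A ℤ.- + 2) ℤ.* (u ℤ.* t ℤ.- v ℤ.* + 2 ℤ.- + 2) ℤ.* (u ℤ.* B ℤ.- v ℤ.* A ℤ.- + 2 ℤ.+ + 4)
    ℤ.+ (u ℤ.* u ℤ.* ((B ℤ.* B ℤ.- t ℤ.* A ℤ.* B ℤ.+ A ℤ.* A) ℤ.- (+ 4 ℤ.- t ℤ.* t))
         ℤ.- (A ℤ.* A ℤ.- + 4) ℤ.* ((u ℤ.* u ℤ.- t ℤ.* u ℤ.* v ℤ.+ v ℤ.* v) ℤ.- + 1))
  fricke = ℤ-Solver.solve-∀

-- The symmetry lets `Markov-∣` run backwards, from W (n + m) and W m to W n.
Markov-rotate : ∀ x y z → Markov x y z → Markov z x y
Markov-rotate x y z h = ℤ.i-j≡0⇒i≡j _ _ (trans (rotate x y z) (ℤ.i≡j⇒i-j≡0 h))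
  where
  rotate : ∀ x y z → (y ℤ.- z ℤ.- x) ℤ.* (y ℤ.- z ℤ.- x) ℤ.- z ℤ.* x ℤ.* (y ℤ.+ + 4)
    ≡ (z ℤ.- x ℤ.- y) ℤ.* (z ℤ.- x ℤ.- y) ℤ.- x ℤ.* y ℤ.* (z ℤ.+ + 4)
  rotate = ℤ-Solver.solve-∀

-- d² divides x y, hence (z − x − y)², so d divides z − x − y.
Markov-∣ : ∀ x y z {d} → Markov x y z → d ∣ ∣ x ∣ → d ∣ ∣ y ∣ → d ∣ ∣ z ∣
Markov-∣ x y z {d} h d∣x d∣y = ℤ∣.∣⇒∣ᵤ {+ d} {z}
  (subst (+ d ℤ∣.∣_) (regroup x y z) (ℤ∣.∣m∣n⇒∣m+n
    (ℤ∣.∣ᵤ⇒∣ {+ d} {e} (square-∣ d ∣ e ∣ d²∣e²))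
    (ℤ∣.∣m∣n⇒∣m+n (ℤ∣.∣ᵤ⇒∣ {+ d} {x} d∣x) (ℤ∣.∣ᵤ⇒∣ {+ d} {y} d∣y))))
  where
  e = z ℤ.- x ℤ.- y
  regroup : ∀ x y z → z ℤ.- x ℤ.- y ℤ.+ (x ℤ.+ y) ≡ z
  regroup = ℤ-Solver.solve-∀
  d²∣e² : d * d ∣ ∣ e ∣ * ∣ e ∣
  d²∣e² = subst (d * d ∣_)
    (trans (sym (trans (ℤ.abs-* (x ℤ.* y) (z ℤ.+ + 4)) (cong (_* ∣ z ℤ.+ + 4 ∣) (ℤ.abs-* x y))))
      (trans (cong ∣_∣ (sym h)) (ℤ.abs-* e e)))
    (∣m⇒∣m*n ∣ z ℤ.+ + 4 ∣ (*-pres-∣ d∣x d∣y))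

w : ℤ → ℕ → ℕ
w t n = ∣ W t n ∣

module _ (t : ℤ) where

  w-∣-+ : ∀ {d} m n → d ∣ w t m → d ∣ w t n → d ∣ w t (n + m)
  w-∣-+ m n = Markov-∣ (W t m) (W t n) (W t (n + m)) (W-markov t m n)

  w-∣-+-cancel : ∀ {d} m n → d ∣ w t (n + m) → d ∣ w t m → d ∣ w t n
  w-∣-+-cancel m n = Markov-∣ (W t (n + m)) (W t m) (W t n)
    (Markov-rotate (W t m) (W t n) (W t (n + m)) (W-markov t m n))

  w-∣-* : ∀ {d} k m → d ∣ w t m → d ∣ w t (k * m)
  w-∣-* zero    m h = _ ∣0
  w-∣-* (suc k) m h = w-∣-+ (k * m) m (w-∣-* k m h) h

  -- The indices at which d divides `w` are closed under sums and cancellation, so Bézout with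
  -- natural coefficients applies.
  w-∣-gcd : ∀ {d} m n → d ∣ w t m → d ∣ w t n → d ∣ w t (gcd m n)
  w-∣-gcd {d} m n d∣m d∣n with Bézout.identity (gcd-GCD m n)
  ... | Bézout.+- x y eq = w-∣-+-cancel (y * n) (gcd m n)
    (subst (λ k → d ∣ w t k) (sym eq) (w-∣-* x m d∣m)) (w-∣-* y n d∣n)
  ... | Bézout.-+ x y eq = w-∣-+-cancel (x * m) (gcd m n)
    (subst (λ k → d ∣ w t k) (sym eq) (w-∣-* y n d∣n)) (w-∣-* x m d∣m)

  w-mono-∣ : ∀ {m n} → m ∣ n → w t m ∣ w t n
  w-mono-∣ {m} (divides k refl) = w-∣-* k m ∣-refl

  gcd-w : ∀ m n → gcd (w t m) (w t n) ≡ w t (gcd m n)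
  gcd-w m n = ∣-antisym (w-∣-gcd m n (gcd[m,n]∣m (w t m) (w t n)) (gcd[m,n]∣n (w t m) (w t n)))
    (gcd-greatest (w-mono-∣ (gcd[m,n]∣m m n)) (w-mono-∣ (gcd[m,n]∣n m n)))

-- Expansions at the trace 2 and square quotients

-- Taylor expansion at 2, the trace of the unit 1. The coefficient q² shows later that a prime
-- dividing both W m and the quotient W (q m) / W m divides q.
V-expand : ∀ x q → ∃ λ X → V (+ 2 ℤ.+ x) q ≡ + 2 ℤ.+ + q ℤ.* + q ℤ.* x ℤ.+ x ℤ.* x ℤ.* X
V-expand x zero          = 0ℤ , base x
  where
  base : ∀ x → + 2 ≡ + 2 ℤ.+ 0ℤ ℤ.* 0ℤ ℤ.* x ℤ.+ x ℤ.* x ℤ.* 0ℤ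
  base = ℤ-Solver.solve-∀
V-expand x (suc zero)    = 0ℤ , base x
  where
  base : ∀ x → + 2 ℤ.+ x ≡ + 2 ℤ.+ + 1 ℤ.* + 1 ℤ.* x ℤ.+ x ℤ.* x ℤ.* 0ℤ
  base = ℤ-Solver.solve-∀
V-expand x (suc (suc q)) with V-expand x q | V-expand x (suc q)
... | X , eq | Y , eq′ = _ , trans (cong₂ (λ a b → (+ 2 ℤ.+ x) ℤ.* a ℤ.- b) eq′ eq) (step x (+ q) X Y)
  where
  step : ∀ x q X Y → (+ 2 ℤ.+ x) ℤ.* (+ 2 ℤ.+ (+ 1 ℤ.+ q) ℤ.* (+ 1 ℤ.+ q) ℤ.* x ℤ.+ x ℤ.* x ℤ.* Y)
      ℤ.- (+ 2 ℤ.+ q ℤ.* q ℤ.* x ℤ.+ x ℤ.* x ℤ.* X)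
    ≡ + 2 ℤ.+ (+ 2 ℤ.+ q) ℤ.* (+ 2 ℤ.+ q) ℤ.* x
      ℤ.+ x ℤ.* x ℤ.* (+ 2 ℤ.* Y ℤ.+ (+ 1 ℤ.+ q) ℤ.* (+ 1 ℤ.+ q) ℤ.+ x ℤ.* Y ℤ.- X)
  step = ℤ-Solver.solve-∀

2+W : ∀ t m → V t m ≡ + 2 ℤ.+ W t m
2+W t m = lemma (V t m)
  where
  lemma : ∀ x → x ≡ + 2 ℤ.+ (x ℤ.- + 2)
  lemma = ℤ-Solver.solve-∀

W-* : ∀ t q m → ∃ λ X → W t (q * m) ≡ W t m ℤ.* (+ q ℤ.* + q ℤ.+ W t m ℤ.* X)
W-* t q m with V-expand (W t m) q
... | X , eq = X , trans (cong (ℤ._- + 2) (trans (V-* t q m) (trans (cong (λ x → V x q) (2+W t m)) eq)))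
    (factor (W t m) (+ q) X)
  where
  factor : ∀ x q X → + 2 ℤ.+ q ℤ.* q ℤ.* x ℤ.+ x ℤ.* x ℤ.* X ℤ.- + 2 ≡ x ℤ.* (q ℤ.* q ℤ.+ x ℤ.* X)
  factor = ℤ-Solver.solve-∀

-- With x = β² + β⁻², S x h = (β²ʰ⁺¹ − β⁻²ʰ⁻¹) / (β − β⁻¹).
S : ℤ → ℕ → ℤ
S x 0             = + 1
S x 1             = x ℤ.+ + 1
S x (suc (suc h)) = x ℤ.* S x (suc h) ℤ.- S x h

S-norm : ∀ x h → S x (suc h) ℤ.* S x (suc h) ℤ.- x ℤ.* S x h ℤ.* S x (suc h) ℤ.+ S x h ℤ.* S x h ≡ x ℤ.+ + 2
S-norm x zero = base x
  where
  base : ∀ x → (x ℤ.+ + 1) ℤ.* (x ℤ.+ + 1) ℤ.- x ℤ.* + 1 ℤ.* (x ℤ.+ + 1) ℤ.+ + 1 ℤ.* + 1 ≡ x ℤ.+ + 2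
  base = ℤ-Solver.solve-∀
S-norm x (suc h) = trans (step x (S x h) (S x (suc h))) (S-norm x h)
  where
  step : ∀ t a b → (t ℤ.* b ℤ.- a) ℤ.* (t ℤ.* b ℤ.- a) ℤ.- t ℤ.* b ℤ.* (t ℤ.* b ℤ.- a) ℤ.+ b ℤ.* b
    ≡ b ℤ.* b ℤ.- t ℤ.* a ℤ.* b ℤ.+ a ℤ.* a
  step = ℤ-Solver.solve-∀

-- For x = β² + β⁻² the first line is (βⁿ - β⁻ⁿ)² with n = 2h + 1, divided and multiplied by (β -
-- β⁻¹)². The second line is there to carry the induction.
S-square : ∀ x h →
  W x (1 + 2 * h) ≡ (x ℤ.- + 2) ℤ.* (S x h ℤ.* S x h) ×
  V x (2 + 2 * h) ℤ.- x ≡ (x ℤ.- + 2) ℤ.* (S x h ℤ.* S x (suc h))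
S-square x zero = base₁ x , base₂ x
  where
  base₁ : ∀ x → x ℤ.- + 2 ≡ (x ℤ.- + 2) ℤ.* (+ 1 ℤ.* + 1)
  base₁ = ℤ-Solver.solve-∀
  base₂ : ∀ x → x ℤ.* x ℤ.- + 2 ℤ.- x ≡ (x ℤ.- + 2) ℤ.* (+ 1 ℤ.* (x ℤ.+ + 1))
  base₂ = ℤ-Solver.solve-∀
S-square x (suc h) = subst (λ n → W x (1 + n) ≡ (x ℤ.- + 2) ℤ.* (S x (suc h) ℤ.* S x (suc h)) ×
      V x (2 + n) ℤ.- x ≡ (x ℤ.- + 2) ℤ.* (S x (suc h) ℤ.* S x (2 + h))) (sym (*-suc 2 h)) (odd , even)
  where
  open ≡-Reasoning
  a = V x (1 + 2 * h)
  b = V x (2 + 2 * h)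
  r = S x h
  s = S x (suc h)
  odd : W x (3 + 2 * h) ≡ (x ℤ.- + 2) ℤ.* (s ℤ.* s)
  odd = begin
    x ℤ.* b ℤ.- a ℤ.- + 2
      ≡⟨ split x a b ⟩
    x ℤ.* (b ℤ.- x) ℤ.- (a ℤ.- + 2) ℤ.+ (x ℤ.- + 2) ℤ.* (x ℤ.+ + 2)
      ≡⟨ cong₂ (λ y z → x ℤ.* y ℤ.- z ℤ.+ (x ℤ.- + 2) ℤ.* (x ℤ.+ + 2))
           (proj₂ (S-square x h)) (proj₁ (S-square x h)) ⟩
    x ℤ.* ((x ℤ.- + 2) ℤ.* (r ℤ.* s)) ℤ.- (x ℤ.- + 2) ℤ.* (r ℤ.* r) ℤ.+ (x ℤ.- + 2) ℤ.* (x ℤ.+ + 2)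
      ≡⟨ cong (λ y → x ℤ.* ((x ℤ.- + 2) ℤ.* (r ℤ.* s)) ℤ.- (x ℤ.- + 2) ℤ.* (r ℤ.* r) ℤ.+ (x ℤ.- + 2) ℤ.* y)
           (sym (S-norm x h)) ⟩
    x ℤ.* ((x ℤ.- + 2) ℤ.* (r ℤ.* s)) ℤ.- (x ℤ.- + 2) ℤ.* (r ℤ.* r)
      ℤ.+ (x ℤ.- + 2) ℤ.* (s ℤ.* s ℤ.- x ℤ.* r ℤ.* s ℤ.+ r ℤ.* r)
      ≡⟨ join x r s ⟩
    (x ℤ.- + 2) ℤ.* (s ℤ.* s) ∎
    where
    split : ∀ x a b → x ℤ.* b ℤ.- a ℤ.- + 2 ≡ x ℤ.* (b ℤ.- x) ℤ.- (a ℤ.- + 2) ℤ.+ (x ℤ.- + 2) ℤ.* (x ℤ.+ + 2)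
    split = ℤ-Solver.solve-∀
    join : ∀ x r s → x ℤ.* ((x ℤ.- + 2) ℤ.* (r ℤ.* s)) ℤ.- (x ℤ.- + 2) ℤ.* (r ℤ.* r)
      ℤ.+ (x ℤ.- + 2) ℤ.* (s ℤ.* s ℤ.- x ℤ.* r ℤ.* s ℤ.+ r ℤ.* r) ≡ (x ℤ.- + 2) ℤ.* (s ℤ.* s)
    join = ℤ-Solver.solve-∀
  even : V x (4 + 2 * h) ℤ.- x ≡ (x ℤ.- + 2) ℤ.* (s ℤ.* S x (2 + h))
  even = begin
    x ℤ.* (x ℤ.* b ℤ.- a) ℤ.- b ℤ.- x
      ≡⟨ split x a b ⟩
    x ℤ.* (x ℤ.* b ℤ.- a ℤ.- + 2) ℤ.- (b ℤ.- x)
      ≡⟨ cong₂ (λ y z → x ℤ.* y ℤ.- z) odd (proj₂ (S-square x h)) ⟩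
    x ℤ.* ((x ℤ.- + 2) ℤ.* (s ℤ.* s)) ℤ.- (x ℤ.- + 2) ℤ.* (r ℤ.* s)
      ≡⟨ join x r s ⟩
    (x ℤ.- + 2) ℤ.* (s ℤ.* S x (2 + h)) ∎
    where
    split : ∀ x a b → x ℤ.* (x ℤ.* b ℤ.- a) ℤ.- b ℤ.- x ≡ x ℤ.* (x ℤ.* b ℤ.- a ℤ.- + 2) ℤ.- (b ℤ.- x)
    split = ℤ-Solver.solve-∀
    join : ∀ x r s → x ℤ.* ((x ℤ.- + 2) ℤ.* (s ℤ.* s)) ℤ.- (x ℤ.- + 2) ℤ.* (r ℤ.* s)
      ≡ (x ℤ.- + 2) ℤ.* (s ℤ.* (x ℤ.* s ℤ.- r))
    join = ℤ-Solver.solve-∀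

-- The linear coefficient c is 1² + ... + h². Its sixfold shows that a prime 1 + 2h divides c,
-- unless that prime is 3.
S-expand : ∀ x h → ∃ λ c → ∃ λ Y → S (+ 2 ℤ.+ x) h ≡ + 1 ℤ.+ + 2 ℤ.* + h ℤ.+ c ℤ.* x ℤ.+ x ℤ.* x ℤ.* Y
  × + 6 ℤ.* c ≡ + h ℤ.* (+ h ℤ.+ + 1) ℤ.* (+ 1 ℤ.+ + 2 ℤ.* + h)
S-expand x zero       = 0ℤ , 0ℤ , base x , refl
  where
  base : ∀ x → + 1 ≡ + 1 ℤ.+ + 2 ℤ.* 0ℤ ℤ.+ 0ℤ ℤ.* x ℤ.+ x ℤ.* x ℤ.* 0ℤ
  base = ℤ-Solver.solve-∀
S-expand x (suc zero) = + 1 , 0ℤ , base x , refl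
  where
  base : ∀ x → + 2 ℤ.+ x ℤ.+ + 1 ≡ + 1 ℤ.+ + 2 ℤ.* + 1 ℤ.+ + 1 ℤ.* x ℤ.+ x ℤ.* x ℤ.* 0ℤ
  base = ℤ-Solver.solve-∀
S-expand x (suc (suc h)) with S-expand x h | S-expand x (suc h)
... | c , Y , eq , 6c | c′ , Y′ , eq′ , 6c′ = _ , _ ,
  trans (cong₂ (λ a b → (+ 2 ℤ.+ x) ℤ.* a ℤ.- b) eq′ eq) (step x (+ h) c c′ Y Y′) ,
  trans (six c c′ (+ h)) (trans
    (cong₂ (λ a b → + 2 ℤ.* a ℤ.- b ℤ.+ + 6 ℤ.* (+ 3 ℤ.+ + 2 ℤ.* + h)) 6c′ 6c)
    (cubic (+ h)))
  where
  step : ∀ x h c c′ Y Y′ →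
    (+ 2 ℤ.+ x) ℤ.* (+ 1 ℤ.+ + 2 ℤ.* (+ 1 ℤ.+ h) ℤ.+ c′ ℤ.* x ℤ.+ x ℤ.* x ℤ.* Y′)
      ℤ.- (+ 1 ℤ.+ + 2 ℤ.* h ℤ.+ c ℤ.* x ℤ.+ x ℤ.* x ℤ.* Y)
    ≡ + 1 ℤ.+ + 2 ℤ.* (+ 2 ℤ.+ h) ℤ.+ (+ 2 ℤ.* c′ ℤ.- c ℤ.+ (+ 3 ℤ.+ + 2 ℤ.* h)) ℤ.* x
      ℤ.+ x ℤ.* x ℤ.* (c′ ℤ.+ + 2 ℤ.* Y′ ℤ.- Y ℤ.+ x ℤ.* Y′)
  step = ℤ-Solver.solve-∀
  six : ∀ c c′ h → + 6 ℤ.* (+ 2 ℤ.* c′ ℤ.- c ℤ.+ (+ 3 ℤ.+ + 2 ℤ.* h))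
    ≡ + 2 ℤ.* (+ 6 ℤ.* c′) ℤ.- + 6 ℤ.* c ℤ.+ + 6 ℤ.* (+ 3 ℤ.+ + 2 ℤ.* h)
  six = ℤ-Solver.solve-∀
  cubic : ∀ h → + 2 ℤ.* ((+ 1 ℤ.+ h) ℤ.* (+ 1 ℤ.+ h ℤ.+ + 1) ℤ.* (+ 1 ℤ.+ + 2 ℤ.* (+ 1 ℤ.+ h)))
      ℤ.- h ℤ.* (h ℤ.+ + 1) ℤ.* (+ 1 ℤ.+ + 2 ℤ.* h) ℤ.+ + 6 ℤ.* (+ 3 ℤ.+ + 2 ℤ.* h)
    ≡ (+ 2 ℤ.+ h) ℤ.* (+ 2 ℤ.+ h ℤ.+ + 1) ℤ.* (+ 1 ℤ.+ + 2 ℤ.* (+ 2 ℤ.+ h))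
  cubic = ℤ-Solver.solve-∀

-- Size of the cofactor

-- This is φ(m · product qs) when `qs` lists the distinct primes dividing that number.
totient : ℕ → List ℕ → ℕ
totient m qs = m * product (map pred qs)

-- The additive counterpart of `new-∷`.
totient-∷ : ∀ m q .{{_ : NonZero q}} qs → totient m qs + totient m (q ∷ qs) ≡ totient (m * q) qs
totient-∷ m (suc q) qs = distrib m q (product (map pred qs))
  where
  distrib : ∀ m q P → m * P + m * (q * P) ≡ m * (1 + q) * P
  distrib = solve-∀

-- `2 ^ slack k` is the loss with k primes: 4 for comparing `w` with `a`, then for each prime two
-- earlier losses and one factor 2.
slack : ℕ → ℕ
slack 0       = 2
slack (suc k) = suc (slack k + slack k)

module Growth (t : ℤ) (3≤∣t∣ : 3 ≤ ∣ t ∣) where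

  a : ℕ → ℕ
  a n = ∣ V t n ∣

  3a≤ : ∀ n → 3 * a (1 + n) ≤ a (2 + n) + a n
  3a≤ n = begin
    3 * a (1 + n)                                ≤⟨ *-monoˡ-≤ (a (1 + n)) 3≤∣t∣ ⟩
    ∣ t ∣ * a (1 + n)                            ≡⟨ ℤ.abs-* t (V t (1 + n)) ⟨
    ∣ t ℤ.* V t (1 + n) ∣                        ≡⟨ cong ∣_∣ (cancel (t ℤ.* V t (1 + n)) (V t n)) ⟩
    ∣ t ℤ.* V t (1 + n) ℤ.- V t n ℤ.+ V t n ∣    ≤⟨ ℤ.∣i+j∣≤∣i∣+∣j∣ (V t (2 + n)) (V t n) ⟩
    a (2 + n) + a n                              ∎
    where
    open ≤-Reasoning
    cancel : ∀ x y → x ≡ x ℤ.- y ℤ.+ y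
    cancel = ℤ-Solver.solve-∀

  -- Mutual induction: monotonicity at n turns `3a≤` into doubling, and doubling gives monotonicity
  -- at n + 1.
  a-suc : ∀ n → a n ≤ a (suc n)
  a-double : ∀ n → 2 * a (1 + n) ≤ a (2 + n)

  a-suc zero    = ≤-trans (s≤s (s≤s z≤n)) 3≤∣t∣
  a-suc (suc n) = ≤-trans (m≤n*m (a (suc n)) 2) (a-double n)

  a-double n = +-cancelˡ-≤ (a (1 + n)) _ _ (begin
    3 * a (1 + n)            ≤⟨ 3a≤ n ⟩
    a (2 + n) + a n          ≤⟨ +-monoʳ-≤ (a (2 + n)) (a-suc n) ⟩
    a (2 + n) + a (1 + n)    ≡⟨ +-comm (a (2 + n)) (a (1 + n)) ⟩
    a (1 + n) + a (2 + n)    ∎)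
    where open ≤-Reasoning

  a-mono : ∀ {m n} → m ≤ n → a m ≤ a n
  a-mono {m} m≤n = go (≤⇒≤′ m≤n)
    where
    go : ∀ {n} → m ≤′ n → a m ≤ a n
    go ≤′-refl     = ≤-refl
    go (≤′-step {n} h) = ≤-trans (go h) (a-suc n)

  2≤a : ∀ n → 2 ≤ a n
  2≤a n = a-mono {0} {n} z≤n

  3≤a : ∀ n .{{_ : NonZero n}} → 3 ≤ a n
  3≤a (suc n) = ≤-trans 3≤∣t∣ (a-mono {1} {suc n} (s≤s z≤n))

  2^n≤a : ∀ n → 2 ^ n ≤ a n
  2^n≤a zero          = s≤s z≤n
  2^n≤a (suc zero)    = ≤-trans (s≤s (s≤s z≤n)) 3≤∣t∣
  2^n≤a (suc (suc n)) = ≤-trans (*-monoʳ-≤ 2 (2^n≤a (suc n))) (a-double n)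

  a≢0 : ∀ n → NonZero (a n)
  a≢0 n = >-nonZero (≤-trans (s≤s z≤n) (2≤a n))

  +-≤-2* : ∀ {x y z} → x ≤ y → z ≤ y → x + z ≤ 2 * y
  +-≤-2* {y = y} h g = ≤-trans (+-mono-≤ h g) (≤-reflexive (cong (λ s → y + s) (sym (+-identityʳ y))))

  a-submultiplicative-≤ : ∀ m k → a (m + (m + k)) ≤ 2 * (a m * a (m + k))
  a-submultiplicative-≤ m k = begin
    a (m + (m + k))                  ≡⟨ cong ∣_∣ (V-+ t m k) ⟩
    ∣ V t m ℤ.* V t (m + k) ℤ.- V t k ∣  ≤⟨ ℤ.∣i-j∣≤∣i∣+∣j∣ (V t m ℤ.* V t (m + k)) (V t k) ⟩
    ∣ V t m ℤ.* V t (m + k) ∣ + a k  ≡⟨ cong (_+ a k) (ℤ.abs-* (V t m) (V t (m + k))) ⟩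
    a m * a (m + k) + a k            ≤⟨ +-≤-2* ≤-refl
                                          (≤-trans (a-mono (m≤n+m k m)) (m≤n*m (a (m + k)) (a m) {{a≢0 m}})) ⟩
    2 * (a m * a (m + k))            ∎
    where open ≤-Reasoning

  a-supermultiplicative-≤ : ∀ m k → a m * a (m + k) ≤ 2 * a (m + (m + k))
  a-supermultiplicative-≤ m k = begin
    a m * a (m + k)                               ≡⟨ ℤ.abs-* (V t m) (V t (m + k)) ⟨
    ∣ V t m ℤ.* V t (m + k) ∣                     ≡⟨ cong ∣_∣ (cancel (V t m ℤ.* V t (m + k)) (V t k)) ⟩
    ∣ V t m ℤ.* V t (m + k) ℤ.- V t k ℤ.+ V t k ∣ ≡⟨ cong (λ x → ∣ x ℤ.+ V t k ∣) (V-+ t m k) ⟨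
    ∣ V t (m + (m + k)) ℤ.+ V t k ∣               ≤⟨ ℤ.∣i+j∣≤∣i∣+∣j∣ (V t (m + (m + k))) (V t k) ⟩
    a (m + (m + k)) + a k                         ≤⟨ +-≤-2* ≤-refl (a-mono (≤-trans (m≤n+m k m) (m≤n+m (m + k) m))) ⟩
    2 * a (m + (m + k))                           ∎
    where
    open ≤-Reasoning
    cancel : ∀ x y → x ≡ x ℤ.- y ℤ.+ y
    cancel = ℤ-Solver.solve-∀

  private
    symmetric : (P : ℕ → ℕ → Set) → (∀ {m n} → P m n → P n m) → (∀ m k → P m (m + k)) → ∀ m n → P m n
    symmetric P P-sym h m n with ≤-total m n
    ... | inj₁ m≤n = subst (P m) (m+[n∸m]≡n m≤n) (h m (n ∸ m))
    ... | inj₂ n≤m = P-sym (subst (P n) (m+[n∸m]≡n n≤m) (h n (m ∸ n)))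

  a-+-≤ : ∀ m n → a (m + n) ≤ 2 * (a m * a n)
  a-+-≤ = symmetric (λ m n → a (m + n) ≤ 2 * (a m * a n))
    (λ {m} {n} → subst₂ (λ i j → a i ≤ 2 * j) (+-comm m n) (*-comm (a m) (a n))) a-submultiplicative-≤

  a-*-≤ : ∀ m n → a m * a n ≤ 2 * a (m + n)
  a-*-≤ = symmetric (λ m n → a m * a n ≤ 2 * a (m + n))
    (λ {m} {n} → subst₂ (λ i j → j ≤ 2 * a i) (+-comm m n) (*-comm (a m) (a n))) a-supermultiplicative-≤

  w≤2a : ∀ n → w t n ≤ 2 * a n
  w≤2a n = ≤-trans (ℤ.∣i-j∣≤∣i∣+∣j∣ (V t n) (+ 2)) (+-≤-2* ≤-refl (2≤a n))

  a≤w+2 : ∀ n → a n ≤ w t n + 2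
  a≤w+2 n = ≤-trans (≤-reflexive (cong ∣_∣ (cancel (V t n)))) (ℤ.∣i+j∣≤∣i∣+∣j∣ (W t n) (+ 2))
    where
    cancel : ∀ x → x ≡ x ℤ.- + 2 ℤ.+ + 2
    cancel = ℤ-Solver.solve-∀

  1≤w : ∀ n .{{_ : NonZero n}} → 1 ≤ w t n
  1≤w n = +-cancelʳ-≤ 2 1 (w t n) (≤-trans (3≤a n) (a≤w+2 n))

  w≢0 : ∀ n .{{_ : NonZero n}} → NonZero (w t n)
  w≢0 n = >-nonZero (1≤w n)

  a≤4w : ∀ n .{{_ : NonZero n}} → a n ≤ 4 * w t n
  a≤4w n = begin
    a n                    ≤⟨ a≤w+2 n ⟩
    w t n + 2              ≤⟨ +-monoʳ-≤ (w t n) (*-monoʳ-≤ 2 (1≤w n)) ⟩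
    w t n + 2 * w t n      ≤⟨ m≤n+m (3 * w t n) (w t n) ⟩
    4 * w t n              ∎
    where open ≤-Reasoning

  open StrongDivisibility (w t) w≢0 (gcd-w t) public

  -- The new cofactor is a quotient by `new-∷`, so its upper bound needs the lower bound of the
  -- divisor and vice versa; both inequalities go through one induction. Comparison with `a`, not
  -- with powers of ∣ t ∣, keeps the loss independent of t.
  new-bounds : ∀ m .{{_ : NonZero m}} {qs} → All NonZero qs → AllPairs Coprime qs →
    new m qs ≤ 2 ^ slack (length qs) * a (totient m qs) ×
    a (totient m qs) ≤ 2 ^ slack (length qs) * new m qs
  new-bounds m {[]} [] [] = subst₂ (λ x n → x ≤ 4 * a n × a n ≤ 4 * x) new≡w (sym (*-identityʳ m))
      (≤-trans (w≤2a m) (*-monoˡ-≤ (a m) {2} {4} (s≤s (s≤s z≤n))) , a≤4w m)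
    where
    new≡w : w t m ≡ new m []
    new≡w = trans (cong (w t) (sym (*-identityʳ m))) (trans (sym (new*old m [])) (*-identityʳ (new m [])))
  new-bounds m {q ∷ qs} (q≢0 ∷ qs≢0) (q⊥qs ∷ qs⊥) = upper , lower
    where
    open ≤-Reasoning
    instance _ = q≢0
    c = slack (length qs)
    X = new m (q ∷ qs)
    Y = new m qs
    Z = new (m * q) qs
    x = totient m (q ∷ qs)
    y = totient m qs
    XY≡Z : X * Y ≡ Z
    XY≡Z = new-∷ m q qs≢0 q⊥qs
    x+y≡z : y + x ≡ totient (m * q) qs
    x+y≡z = totient-∷ m q qs
    IHm = new-bounds m qs≢0 qs⊥
    IHmq = new-bounds (m * q) {{m*n≢0 m q}} qs≢0 qs⊥
    2^1+2c : ∀ z → 2 ^ c * (2 ^ c * (2 * z)) ≡ 2 ^ suc (c + c) * z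
    2^1+2c z = trans (assoc (2 ^ c) z) (cong (λ e → 2 * e * z) (sym (^-distribˡ-+-* 2 c c)))
      where
      assoc : ∀ p z → p * (p * (2 * z)) ≡ 2 * (p * p) * z
      assoc = solve-∀
    perm : ∀ p q r → p * (q * r) ≡ q * (p * r)
    perm = solve-∀
    upper : X ≤ 2 ^ suc (c + c) * a x
    upper = *-cancelˡ-≤ (a y) {{a≢0 y}} (begin
      a y * X                              ≡⟨ *-comm (a y) X ⟩
      X * a y                              ≤⟨ *-monoʳ-≤ X (proj₂ IHm) ⟩
      X * (2 ^ c * Y)                      ≡⟨ perm X (2 ^ c) Y ⟩
      2 ^ c * (X * Y)                      ≡⟨ cong (2 ^ c *_) XY≡Z ⟩
      2 ^ c * Z                            ≤⟨ *-monoʳ-≤ (2 ^ c) (proj₁ IHmq) ⟩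
      2 ^ c * (2 ^ c * a (totient (m * q) qs)) ≡⟨ cong (λ n → 2 ^ c * (2 ^ c * a n)) x+y≡z ⟨
      2 ^ c * (2 ^ c * a (y + x))          ≤⟨ *-monoʳ-≤ (2 ^ c) (*-monoʳ-≤ (2 ^ c) (a-+-≤ y x)) ⟩
      2 ^ c * (2 ^ c * (2 * (a y * a x)))  ≡⟨ 2^1+2c (a y * a x) ⟩
      2 ^ suc (c + c) * (a y * a x)        ≡⟨ perm (2 ^ suc (c + c)) (a y) (a x) ⟩
      a y * (2 ^ suc (c + c) * a x)        ∎)
    lower : a x ≤ 2 ^ suc (c + c) * X
    lower = *-cancelˡ-≤ (a y) {{a≢0 y}} (begin
      a y * a x                            ≤⟨ a-*-≤ y x ⟩
      2 * a (y + x)                        ≡⟨ cong (λ n → 2 * a n) x+y≡z ⟩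
      2 * a (totient (m * q) qs)           ≤⟨ *-monoʳ-≤ 2 (proj₂ IHmq) ⟩
      2 * (2 ^ c * Z)                      ≡⟨ cong (λ n → 2 * (2 ^ c * n)) XY≡Z ⟨
      2 * (2 ^ c * (X * Y))                ≤⟨ *-monoʳ-≤ 2 (*-monoʳ-≤ (2 ^ c) (*-monoʳ-≤ X (proj₁ IHm))) ⟩
      2 * (2 ^ c * (X * (2 ^ c * a y)))    ≡⟨ shuffle (2 ^ c) X (a y) ⟩
      2 ^ c * (2 ^ c * (2 * (a y * X)))    ≡⟨ 2^1+2c (a y * X) ⟩
      2 ^ suc (c + c) * (a y * X)          ≡⟨ perm (2 ^ suc (c + c)) (a y) X ⟩
      a y * (2 ^ suc (c + c) * X)          ∎)
      where
      shuffle : ∀ p X y → 2 * (p * (X * (p * y))) ≡ p * (p * (2 * (y * X)))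
      shuffle = solve-∀

-- Prime divisors and the divisibility A ∣ n²

primeDivisor : ∀ n .{{_ : NonZero n}} → n ≢ 1 → ∃ λ p → Prime p × p ∣ n
primeDivisor n n≢1 with factorise n
... | record { factors = [] ; isFactorisation = n≡1 } = ⊥-elim (n≢1 n≡1)
... | record { factors = p ∷ ps ; isFactorisation = n≡ ; factorsPrime = pp ∷ _ } =
  p , pp , subst (p ∣_) (sym n≡) (m∣m*n (product ps))

prime∣prime⇒≡ : ∀ {p q} → Prime p → Prime q → p ∣ q → p ≡ q
prime∣prime⇒≡ pp pq p∣q with prime⇒irreducible pq p∣q
... | inj₁ refl = ⊥-elim (¬prime[1] pp)
... | inj₂ p≡q  = p≡q

distinct-primes⇒coprime : ∀ {p q} → Prime p → Prime q → p ≢ q → Coprime p q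
distinct-primes⇒coprime pp pq p≢q (d∣p , d∣q) with prime⇒irreducible pp d∣p
... | inj₁ d≡1  = d≡1
... | inj₂ refl = ⊥-elim (p≢q (prime∣prime⇒≡ pp pq d∣q))

-- Strong induction replaces valuations: all copies of a prime p, one or two, are removed from A,
-- and one copy from n.
∣⇒∣n*n : ∀ n .{{_ : NonZero n}} A .{{_ : NonZero A}} →
  (∀ p → Prime p → p ∣ A → (p ∣ n) × ¬ p * p * p ∣ A) → A ∣ n * n
∣⇒∣n*n n A = <-rec (λ A → ∀ n .{{_ : NonZero n}} .{{_ : NonZero A}} →
  (∀ p → Prime p → p ∣ A → (p ∣ n) × ¬ p * p * p ∣ A) → A ∣ n * n) step A n
  where
  step : ∀ A → (∀ {B} → B < A → ∀ n .{{_ : NonZero n}} .{{_ : NonZero B}} →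
      (∀ p → Prime p → p ∣ B → (p ∣ n) × ¬ p * p * p ∣ B) → B ∣ n * n) →
    ∀ n .{{_ : NonZero n}} .{{_ : NonZero A}} →
      (∀ p → Prime p → p ∣ A → (p ∣ n) × ¬ p * p * p ∣ A) → A ∣ n * n
  step A rec n h with A ≟ 1
  ... | yes refl = 1∣ (n * n)
  ... | no A≢1 with primeDivisor A A≢1
  ...   | p , pp , divides A₁ refl with h p pp (n∣m*n A₁)
  ...     | divides n₁ refl , ¬p³∣A = go (p ∣? A₁)
    where
    instance
      n₁≢0 : NonZero n₁
      n₁≢0 = m*n≢0⇒m≢0 n₁ {p}
      A₁≢0 : NonZero A₁
      A₁≢0 = m*n≢0⇒m≢0 A₁ {p}
      _ = prime⇒nonTrivial pp
    cofactor : ∀ {B} .{{_ : NonZero B}} → B < A₁ * p → B ∣ A₁ * p → ¬ p ∣ B → B ∣ n₁ * n₁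
    cofactor {B} B<A B∣A p∤B = rec B<A n₁ λ r pr r∣B →
      let r∣n , ¬r³∣A = h r pr (∣-trans r∣B B∣A) in
      coprime-p r pr r∣B r∣n , λ r³∣B → ¬r³∣A (∣-trans r³∣B B∣A)
      where
      coprime-p : ∀ r → Prime r → r ∣ B → r ∣ n₁ * p → r ∣ n₁
      coprime-p r pr r∣B r∣n with euclidsLemma n₁ p pr r∣n
      ... | inj₁ r∣n₁ = r∣n₁
      ... | inj₂ r∣p  = ⊥-elim (p∤B (subst (_∣ B) (prime∣prime⇒≡ pr pp r∣p) r∣B))
    p>1 : 1 < p
    p>1 = nonTrivial⇒n>1 p
    go : Dec (p ∣ A₁) → A₁ * p ∣ n₁ * p * (n₁ * p)
    go (no p∤A₁) = subst (A₁ * p ∣_) (rearrange n₁ p)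
      (∣m⇒∣m*n p (*-monoˡ-∣ p (cofactor (m<m*n A₁ p p>1) (m∣m*n p) p∤A₁)))
      where
      rearrange : ∀ n p → n * n * p * p ≡ n * p * (n * p)
      rearrange = solve-∀
    go (yes (divides A₂ refl)) = subst₂ _∣_ (sym (*-assoc A₂ p p)) (rearrange n₁ p)
      (*-monoˡ-∣ (p * p) (cofactor (<-trans (m<m*n A₂ p p>1) (m<m*n (A₂ * p) p p>1))
        (∣-trans (m∣m*n p) (m∣m*n p))
        λ { (divides A₃ refl) → ¬p³∣A (divides A₃ (cube A₃ p)) }))
      where
      instance
        A₂≢0 : NonZero A₂
        A₂≢0 = m*n≢0⇒m≢0 A₂ {p}
      rearrange : ∀ n p → n * n * (p * p) ≡ n * p * (n * p)
      rearrange = solve-∀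
      cube : ∀ a p → a * p * p * p ≡ a * (p * p * p)
      cube = solve-∀

-- The cofactor is n divided by its radical, so that `old cofactor primes` runs over all n / p.
record PrimeSupport (n : ℕ) : Set where
  field
    cofactor  : ℕ
    primes    : List ℕ
    equality  : n ≡ cofactor * product primes
    allPrime  : All Prime primes
    coprime   : AllPairs Coprime primes
    complete  : ∀ p → Prime p → p ∣ n → p ∈ primes

primeSupport : ∀ n .{{_ : NonZero n}} → PrimeSupport n
primeSupport n = subst PrimeSupport (sym isFactorisation) (go factors factorsPrime)
  where
  open PrimeFactorisation (factorise n)
  open PrimeSupport
  go : ∀ ps → All Prime ps → PrimeSupport (product ps)
  go [] [] = record
    { cofactor = 1 ; primes = [] ; equality = refl ; allPrime = [] ; coprime = []
    ; complete = λ p pp p∣1 → ⊥-elim (¬prime[1] (subst Prime (∣1⇒≡1 p∣1) pp)) }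
  go (p ∷ ps) (pp ∷ pps) with go ps pps
  ... | s with any? (p ≟_) (primes s)
  ...   | yes p∈s = record
    { cofactor = p * cofactor s ; primes = primes s
    ; equality = trans (cong (p *_) (equality s)) (sym (*-assoc p (cofactor s) _))
    ; allPrime = allPrime s ; coprime = coprime s ; complete = cover }
    where
    cover : ∀ r → Prime r → r ∣ p * product ps → r ∈ primes s
    cover r pr r∣ with euclidsLemma p (product ps) pr r∣
    ... | inj₁ r∣p = subst (_∈ primes s) (sym (prime∣prime⇒≡ pr pp r∣p)) p∈s
    ... | inj₂ r∣P = complete s r pr r∣P
  ...   | no p∉s = record
    { cofactor = cofactor s ; primes = p ∷ primes s
    ; equality = trans (cong (p *_) (equality s)) (rotate p (cofactor s) _)
    ; allPrime = pp ∷ allPrime s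
    ; coprime = All.tabulate (λ r∈s → distinct-primes⇒coprime pp (All.lookup (allPrime s) r∈s)
        λ { refl → p∉s r∈s }) ∷ coprime s
    ; complete = cover }
    where
    rotate : ∀ p c P → p * (c * P) ≡ c * (p * P)
    rotate = solve-∀
    cover : ∀ r → Prime r → r ∣ p * product ps → r ∈ p ∷ primes s
    cover r pr r∣ with euclidsLemma p (product ps) pr r∣
    ... | inj₁ r∣p = here (prime∣prime⇒≡ pr pp r∣p)
    ... | inj₂ r∣P = there (complete s r pr r∣P)

-- Lower bounds for the totient

-- 8 q ≤ (q − 1)³ for every prime q except 2 and 3, where it fails by the factors
-- 16 and 3; the parameters x and y keep track of which of these two have not been used.
totient-lower : ∀ x y → x ≤ 16 → y ≤ 3 → ∀ {qs} → All Prime qs → AllPairs Coprime qs →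
  x ≡ 1 ⊎ All (Coprime 2) qs → y ≡ 1 ⊎ All (Coprime 3) qs →
  let P = product (map pred qs) in
  8 ^ length qs * product qs * (x * y) ≤ 48 * (P * P * P)
totient-lower x y x≤16 y≤3 [] [] _ _ = begin
  1 * (x * y)  ≡⟨ *-identityˡ (x * y) ⟩
  x * y        ≤⟨ *-mono-≤ x≤16 y≤3 ⟩
  48           ∎
  where open ≤-Reasoning
totient-lower x y x≤16 y≤3 {q ∷ qs} (pq ∷ pqs) (q⊥qs ∷ qs⊥) = go q pq q⊥qs
  where
  open ≤-Reasoning
  E = 8 ^ length qs
  Q = product qs
  P = product (map pred qs)
  go : ∀ q → Prime q → All (Coprime q) qs →
    x ≡ 1 ⊎ All (Coprime 2) (q ∷ qs) → y ≡ 1 ⊎ All (Coprime 3) (q ∷ qs) →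
    8 * E * (q * Q) * (x * y) ≤ 48 * (pred q * P * (pred q * P) * (pred q * P))
  go 0 p0 _ _ _ = ⊥-elim (¬prime[0] p0)
  go 1 p1 _ _ _ = ⊥-elim (¬prime[1] p1)
  go 2 _ _ (inj₂ (2⊥2 ∷ _)) _ with () ← 2⊥2 (∣-refl , ∣-refl)
  go 2 _ 2⊥qs (inj₁ refl) h = begin
    8 * E * (2 * Q) * (1 * y)   ≡⟨ regroup E Q y ⟩
    E * Q * (16 * y)            ≤⟨ totient-lower 16 y ≤-refl y≤3 pqs qs⊥ (inj₂ 2⊥qs) (tail h) ⟩
    48 * (P * P * P)            ≡⟨ unit P ⟩
    48 * (1 * P * (1 * P) * (1 * P)) ∎
    where
    tail : y ≡ 1 ⊎ All (Coprime 3) (2 ∷ qs) → y ≡ 1 ⊎ All (Coprime 3) qs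
    tail (inj₁ e)        = inj₁ e
    tail (inj₂ (_ ∷ cs)) = inj₂ cs
    regroup : ∀ E Q y → 8 * E * (2 * Q) * (1 * y) ≡ E * Q * (16 * y)
    regroup = solve-∀
    unit : ∀ P → 48 * (P * P * P) ≡ 48 * (1 * P * (1 * P) * (1 * P))
    unit = solve-∀
  go 3 _ _ _ (inj₂ (3⊥3 ∷ _)) with () ← 3⊥3 (∣-refl , ∣-refl)
  go 3 _ 3⊥qs h (inj₁ refl) = begin
    8 * E * (3 * Q) * (x * 1)   ≡⟨ regroup E Q x ⟩
    8 * (E * Q * (x * 3))       ≤⟨ *-monoʳ-≤ 8 (totient-lower x 3 x≤16 ≤-refl pqs qs⊥ (tail h) (inj₂ 3⊥qs)) ⟩
    8 * (48 * (P * P * P))      ≡⟨ unit P ⟩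
    48 * (2 * P * (2 * P) * (2 * P)) ∎
    where
    tail : x ≡ 1 ⊎ All (Coprime 2) (3 ∷ qs) → x ≡ 1 ⊎ All (Coprime 2) qs
    tail (inj₁ e)        = inj₁ e
    tail (inj₂ (_ ∷ cs)) = inj₂ cs
    regroup : ∀ E Q x → 8 * E * (3 * Q) * (x * 1) ≡ 8 * (E * Q * (x * 3))
    regroup = solve-∀
    unit : ∀ P → 8 * (48 * (P * P * P)) ≡ 48 * (2 * P * (2 * P) * (2 * P))
    unit = solve-∀
  go 4 p4 _ _ _ = ⊥-elim (composite⇒¬prime composite[4] p4)
  go q@(suc (suc (suc (suc (suc j))))) _ _ hx hy = begin
    8 * E * (q * Q) * (x * y)   ≡⟨ regroup E Q q (x * y) ⟩
    8 * q * (E * Q * (x * y))   ≤⟨ *-mono-≤ 8q≤ (totient-lower x y x≤16 y≤3 pqs qs⊥ (tail hx) (tail hy)) ⟩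
    (4 + j) * (4 + j) * (4 + j) * (48 * (P * P * P)) ≡⟨ unit (4 + j) P ⟩
    48 * ((4 + j) * P * ((4 + j) * P) * ((4 + j) * P)) ∎
    where
    tail : ∀ {b c} → b ≡ 1 ⊎ All (Coprime c) (q ∷ qs) → b ≡ 1 ⊎ All (Coprime c) qs
    tail (inj₁ e)        = inj₁ e
    tail (inj₂ (_ ∷ cs)) = inj₂ cs
    regroup : ∀ E Q q z → 8 * E * (q * Q) * z ≡ 8 * q * (E * Q * z)
    regroup = solve-∀
    unit : ∀ r P → r * r * r * (48 * (P * P * P)) ≡ 48 * (r * P * (r * P) * (r * P))
    unit = solve-∀
    8q≤ : 8 * (5 + j) ≤ (4 + j) * (4 + j) * (4 + j)
    8q≤ = ≤-trans (m≤m+n (8 * (5 + j)) (24 + 40 * j + 12 * j * j + j * j * j)) (≤-reflexive (expand j))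
      where
      expand : ∀ j → 8 * (5 + j) + (24 + 40 * j + 12 * j * j + j * j * j) ≡ (4 + j) * (4 + j) * (4 + j)
      expand = solve-∀

-- One inequality serves twice: as 8^k = (2^k)³ it makes φ(n) exceed any fixed multiple of 2^ω(n)
-- for large n, and it bounds n by a polynomial in φ(n).
totient-cube : ∀ m .{{_ : NonZero m}} {qs} → All Prime qs → AllPairs Coprime qs →
  let e = totient m qs in 8 ^ length qs * (m * product qs) ≤ 48 * (e * e * e)
totient-cube m {qs} pqs qs⊥ = begin
  8 ^ length qs * (m * product qs)          ≡⟨ regroup (8 ^ length qs) m (product qs) ⟩
  m * (8 ^ length qs * product qs * (1 * 1)) ≤⟨ *-mono-≤ (≤-trans (m≤m*n m m) (m≤m*n (m * m) m))
                                                   (totient-lower 1 1 (s≤s z≤n) (s≤s z≤n) pqs qs⊥ (inj₁ refl) (inj₁ refl)) ⟩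
  m * m * m * (48 * (P * P * P))            ≡⟨ cube m P ⟩
  48 * (m * P * (m * P) * (m * P))          ∎
  where
  open ≤-Reasoning
  P = product (map pred qs)
  regroup : ∀ E m Q → E * (m * Q) ≡ m * (E * Q * (1 * 1))
  regroup = solve-∀
  cube : ∀ m P → m * m * m * (48 * (P * P * P)) ≡ 48 * (m * P * (m * P) * (m * P))
  cube = solve-∀

slack-closed : ∀ k → suc (slack k) ≡ 3 * 2 ^ k
slack-closed zero    = refl
slack-closed (suc k) = trans (double (slack k)) (trans (cong (2 *_) (slack-closed k)) (swap (2 ^ k)))
  where
  double : ∀ c → suc (suc (c + c)) ≡ 2 * suc c
  double = solve-∀
  swap : ∀ x → 2 * (3 * x) ≡ 3 * (2 * x)
  swap = solve-∀

cube-cancel-< : ∀ x y → x * x * x < y * y * y → x < y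
cube-cancel-< x y h = ≰⇒> λ y≤x → <⇒≱ h (*-mono-≤ (*-mono-≤ y≤x y≤x) y≤x)

totient-large : ∀ M m .{{_ : NonZero m}} {qs} → All Prime qs → AllPairs Coprime qs →
  48 * (M * M * M) < m * product qs → M * 2 ^ length qs < totient m qs
totient-large M m {qs} pqs qs⊥ h = cube-cancel-< _ _ (*-cancelˡ-< 48 _ _ (begin-strict
  48 * (M * E * (M * E) * (M * E))      ≡⟨ regroup M E ⟩
  E * E * E * (48 * (M * M * M))        <⟨ *-monoʳ-< (E * E * E) {{m*n≢0 (E * E) E {{m*n≢0 E E}}}} h ⟩
  E * E * E * (m * product qs)          ≡⟨ cong (_* (m * product qs)) (8^ (length qs)) ⟨
  8 ^ length qs * (m * product qs)      ≤⟨ totient-cube m pqs qs⊥ ⟩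
  48 * (totient m qs * totient m qs * totient m qs) ∎))
  where
  open ≤-Reasoning
  E = 2 ^ length qs
  instance
    E≢0 : NonZero E
    E≢0 = m^n≢0 2 (length qs)
  regroup : ∀ M E → 48 * (M * E * (M * E) * (M * E)) ≡ E * E * E * (48 * (M * M * M))
  regroup = solve-∀
  8^ : ∀ k → 8 ^ k ≡ 2 ^ k * 2 ^ k * 2 ^ k
  8^ zero    = refl
  8^ (suc k) = trans (cong (8 *_) (8^ k)) (cubes (2 ^ k))
    where
    cubes : ∀ x → 8 * (x * x * x) ≡ 2 * x * (2 * x) * (2 * x)
    cubes = solve-∀

-- Logarithms are avoided: with f = ⌊e / 16⌋ one has e ≤ 2^(4 + f), hence n ≤ 48 e³ ≤ 2^(18 + 3f).
-- Four times the resulting exponent is 4c + 144 + 24f, which explains 145.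
exponential-beats-polynomial : ∀ e c n → 4 * c ≤ e → 145 ≤ e → n ≤ 48 * (e * e * e) → 2 ^ c * (n * n) < 2 ^ e
exponential-beats-polynomial e c n 4c≤e 145≤e n≤ = begin-strict
  2 ^ c * (n * n)           ≤⟨ *-monoʳ-≤ (2 ^ c) (*-mono-≤ n≤2^ n≤2^) ⟩
  2 ^ c * (2 ^ g * 2 ^ g)   ≡⟨ cong (2 ^ c *_) (^-distribˡ-+-* 2 g g) ⟨
  2 ^ c * 2 ^ (g + g)       ≡⟨ ^-distribˡ-+-* 2 c (g + g) ⟨
  2 ^ (c + (g + g))         <⟨ ^-monoʳ-< 2 (s≤s (s≤s z≤n)) exponent< ⟩
  2 ^ e                     ∎
  where
  open ≤-Reasoning
  f = e / 16
  g = 6 + ((4 + f) + (4 + f) + (4 + f))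
  16f≤e : f * 16 ≤ e
  16f≤e = ≤-trans (m≤n+m (f * 16) (e % 16)) (≤-reflexive (sym (m≡m%n+[m/n]*n e 16)))
  e≤ : e ≤ 2 ^ (4 + f)
  e≤ = begin
    e                     ≡⟨ m≡m%n+[m/n]*n e 16 ⟩
    e % 16 + f * 16       ≤⟨ +-monoˡ-≤ (f * 16) (<⇒≤ (m%n<n e 16)) ⟩
    suc f * 16            ≤⟨ *-monoˡ-≤ 16 (n<2^n f) ⟩
    2 ^ f * 16            ≡⟨ *-comm (2 ^ f) 16 ⟩
    2 ^ 4 * 2 ^ f         ≡⟨ ^-distribˡ-+-* 2 4 f ⟨
    2 ^ (4 + f)           ∎
  n≤2^ : n ≤ 2 ^ g
  n≤2^ = begin
    n                     ≤⟨ n≤ ⟩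
    48 * (e * e * e)      ≤⟨ *-mono-≤ (m≤m+n 48 16) (*-mono-≤ (*-mono-≤ e≤ e≤) e≤) ⟩
    2 ^ 6 * (2 ^ (4 + f) * 2 ^ (4 + f) * 2 ^ (4 + f))
      ≡⟨ cong (2 ^ 6 *_) (trans (cong (_* 2 ^ (4 + f)) (sym (^-distribˡ-+-* 2 (4 + f) (4 + f))))
           (sym (^-distribˡ-+-* 2 (4 + f + (4 + f)) (4 + f)))) ⟩
    2 ^ 6 * 2 ^ (4 + f + (4 + f) + (4 + f)) ≡⟨ ^-distribˡ-+-* 2 6 (4 + f + (4 + f) + (4 + f)) ⟨
    2 ^ g                 ∎
  exponent< : c + (g + g) < e
  exponent< = *-cancelˡ-< 4 _ _ (begin-strict
    4 * (c + (g + g))            ≡⟨ expand c f ⟩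
    4 * c + 144 + 24 * f         <⟨ +-mono-<-≤ (+-mono-≤-< 4c≤e 145≤e) (≤-trans (*-monoˡ-≤ f (m≤m+n 24 8))
                                      (≤-trans (≤-reflexive (32f f)) (*-monoʳ-≤ 2 16f≤e))) ⟩
    e + e + 2 * e                ≡⟨ sum e ⟩
    4 * e                        ∎)
    where
    expand : ∀ c f → 4 * (c + ((6 + ((4 + f) + (4 + f) + (4 + f))) + (6 + ((4 + f) + (4 + f) + (4 + f)))))
      ≡ 4 * c + 144 + 24 * f
    expand = solve-∀
    32f : ∀ f → 32 * f ≡ 2 * (f * 16)
    32f = solve-∀
    sum : ∀ e → e + e + 2 * e ≡ 4 * e
    sum = solve-∀

-- By `totient-large`, φ(n) exceeds 512 · 2^ω(n), a generous bound for both 12 · 2^ω(n), which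
-- covers four times the slack, and 145.
threshold : ℕ
threshold = 48 * (512 * 512 * 512)

totient-dominates : ∀ m .{{_ : NonZero m}} {qs} → All Prime qs → AllPairs Coprime qs →
  threshold < m * product qs →
  let n = m * product qs in 2 ^ slack (length qs) * (n * n) < 2 ^ totient m qs
totient-dominates m {qs} pqs qs⊥ h = exponential-beats-polynomial e (slack k) n 4c≤e 145≤e n≤
  where
  open ≤-Reasoning
  k = length qs
  e = totient m qs
  n = m * product qs
  large : 512 * 2 ^ k ≤ e
  large = <⇒≤ (totient-large 512 m pqs qs⊥ h)
  4c≤e : 4 * slack k ≤ e
  4c≤e = begin
    4 * slack k           ≤⟨ *-monoʳ-≤ 4 (n≤1+n (slack k)) ⟩
    4 * suc (slack k)     ≡⟨ cong (4 *_) (slack-closed k) ⟩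
    4 * (3 * 2 ^ k)       ≡⟨ *-assoc 4 3 (2 ^ k) ⟨
    12 * 2 ^ k            ≤⟨ *-monoˡ-≤ (2 ^ k) (m≤m+n 12 500) ⟩
    512 * 2 ^ k           ≤⟨ large ⟩
    e                     ∎
  145≤e : 145 ≤ e
  145≤e = ≤-trans (*-mono-≤ (m≤m+n 145 367) (m^n>0 2 k)) large
  n≤ : n ≤ 48 * (e * e * e)
  n≤ = ≤-trans (m≤n*m n (8 ^ k) {{m^n≢0 8 k}}) (totient-cube m {qs} pqs qs⊥)

-- Decidability of primitive divisors

isPrimitive? : ∀ a n p → Dec (IsPrimitivePrimeDivisor a n p)
isPrimitive? a n p = prime? p ×-dec (p ∣? ∣ a n ∣) ×-dec
  map′ (λ h m 1≤m m<n → h {m} m<n 1≤m) (λ h {m} m<n 1≤m → h m 1≤m m<n)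
    (allUpTo? {P = λ m → 1 ≤ m → a m ≢ 0ℤ → ¬ p ∣ ∣ a m ∣}
      (λ m → (1 ≤? m) →-dec (¬? (a m ℤ.≟ 0ℤ) →-dec ¬? (p ∣? ∣ a m ∣))) n)

-- A prime dividing a nonzero term is at most its absolute value, so the search is finite.
-- Decidability is what allows the later argument by contradiction and the search for the maximum in
-- `Z[_]≤_`.
hasPrimitive? : ∀ a n → a n ≢ 0ℤ → Dec (HasPrimitivePrimeDivisor a n)
hasPrimitive? a n an≢0 = map′ (λ (p , _ , h) → p , h)
    (λ (p , h) → p , s≤s (∣⇒≤ {{ℤ.≢-nonZero an≢0}} (proj₁ (proj₂ h))) , h)
    (anyUpTo? (isPrimitive? a n) (suc ∣ a n ∣))

-- Exact powers of p in W (p j) / W j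

p³∤[p[1+pv]]² : ∀ {p} → Prime p → ∀ v → let s = + p ℤ.* (+ 1 ℤ.+ + p ℤ.* v) in ¬ p * p * p ∣ ∣ s ℤ.* s ∣
p³∤[p[1+pv]]² {p} pp v h = ¬prime[1] (subst Prime (∣1⇒≡1 p∣1) pp)
  where
  instance _ = prime⇒nonZero pp
  u = + 1 ℤ.+ + p ℤ.* v
  s²≡ : ∣ (+ p ℤ.* u) ℤ.* (+ p ℤ.* u) ∣ ≡ p * p * (∣ u ∣ * ∣ u ∣)
  s²≡ = trans (ℤ.abs-* (+ p ℤ.* u) (+ p ℤ.* u))
    (trans (cong₂ _*_ (ℤ.abs-* (+ p) u) (ℤ.abs-* (+ p) u)) (regroup p ∣ u ∣))
    where
    regroup : ∀ p u → p * u * (p * u) ≡ p * p * (u * u)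
    regroup = solve-∀
  p∣u² : p ∣ ∣ u ∣ * ∣ u ∣
  p∣u² = *-cancelˡ-∣ (p * p) {{m*n≢0 p p}} (subst (p * p * p ∣_) s²≡ h)
  p∣u : p ∣ ∣ u ∣
  p∣u = reduce (euclidsLemma ∣ u ∣ ∣ u ∣ pp p∣u²)
  p∣1 : p ∣ 1
  p∣1 = ℤ∣.∣⇒∣ᵤ {+ p} {+ 1} (ℤ∣.∣m+n∣n⇒∣m (ℤ∣.∣ᵤ⇒∣ {+ p} {u} p∣u) (ℤ∣.∣m⇒∣m*n v (ℤ∣.∣-refl {+ p})))

-- The first factor is a product of three consecutive integers, hence a multiple of 6: one index
-- serves both exceptional primes.
w12 : ∀ t → W t 12 ≡ t ℤ.* (t ℤ.- + 1) ℤ.* (t ℤ.+ + 1) ℤ.*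
  (t ℤ.* (t ℤ.- + 1) ℤ.* (t ℤ.+ + 1) ℤ.* (t ℤ.* t ℤ.- + 4) ℤ.* (t ℤ.* t ℤ.- + 3) ℤ.* (t ℤ.* t ℤ.- + 3))
w12 t = trans (cong (ℤ._- + 2) (trans (V-double t 6) (cong (λ x → x ℤ.* x ℤ.- + 2) (V-double t 3)))) (factor t)
  where
  factor : ∀ t → let v = t ℤ.* (t ℤ.* t ℤ.- + 2) ℤ.- t
                     u = v ℤ.* v ℤ.- + 2 in
    u ℤ.* u ℤ.- + 2 ℤ.- + 2 ≡ t ℤ.* (t ℤ.- + 1) ℤ.* (t ℤ.+ + 1) ℤ.*
    (t ℤ.* (t ℤ.- + 1) ℤ.* (t ℤ.+ + 1) ℤ.* (t ℤ.* t ℤ.- + 4) ℤ.* (t ℤ.* t ℤ.- + 3) ℤ.* (t ℤ.* t ℤ.- + 3))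
  factor = ℤ-Solver.solve-∀

∣w12 : ∀ t {p} → + p ℤ∣.∣ t ℤ.* (t ℤ.- + 1) ℤ.* (t ℤ.+ + 1) → p ∣ w t 12
∣w12 t {p} h = ℤ∣.∣⇒∣ᵤ {+ p} {W t 12} (subst (+ p ℤ∣.∣_) (sym (w12 t)) (ℤ∣.∣m⇒∣m*n
  (t ℤ.* (t ℤ.- + 1) ℤ.* (t ℤ.+ + 1) ℤ.* (t ℤ.* t ℤ.- + 4) ℤ.* (t ℤ.* t ℤ.- + 3) ℤ.* (t ℤ.* t ℤ.- + 3)) h))

2∣t[t-1] : ∀ t → + 2 ℤ∣.∣ t ℤ.* (t ℤ.- + 1)
2∣t[t-1] t = go (t ℤ.%ℕ 2) (ℤ.n%ℕd<d t 2) (ℤ.a≡a%ℕn+[a/ℕn]*n t 2)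
  where
  y = t ℤ./ℕ 2
  cancel : ∀ x → + 1 ℤ.+ x ℤ.- + 1 ≡ x
  cancel = ℤ-Solver.solve-∀
  go : ∀ r → r < 2 → t ≡ + r ℤ.+ y ℤ.* + 2 → + 2 ℤ∣.∣ t ℤ.* (t ℤ.- + 1)
  go 0 _ t≡ = ℤ∣.∣m⇒∣m*n (t ℤ.- + 1) (ℤ∣.divides y (trans t≡ (ℤ.+-identityˡ _)))
  go 1 _ t≡ = ℤ∣.∣n⇒∣m*n t (ℤ∣.divides y (trans (cong (ℤ._- + 1) t≡) (cancel (y ℤ.* + 2))))
  go (suc (suc _)) (s≤s (s≤s ())) _

3∣[t-1]t[t+1] : ∀ t → + 3 ℤ∣.∣ t ℤ.* (t ℤ.- + 1) ℤ.* (t ℤ.+ + 1)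
3∣[t-1]t[t+1] t = go (t ℤ.%ℕ 3) (ℤ.n%ℕd<d t 3) (ℤ.a≡a%ℕn+[a/ℕn]*n t 3)
  where
  y = t ℤ./ℕ 3
  cancel : ∀ x → + 1 ℤ.+ x ℤ.- + 1 ≡ x
  cancel = ℤ-Solver.solve-∀
  collect : ∀ x → + 2 ℤ.+ x ℤ.* + 3 ℤ.+ + 1 ≡ (x ℤ.+ + 1) ℤ.* + 3
  collect = ℤ-Solver.solve-∀
  go : ∀ r → r < 3 → t ≡ + r ℤ.+ y ℤ.* + 3 → + 3 ℤ∣.∣ t ℤ.* (t ℤ.- + 1) ℤ.* (t ℤ.+ + 1)
  go 0 _ t≡ = ℤ∣.∣m⇒∣m*n (t ℤ.+ + 1) (ℤ∣.∣m⇒∣m*n (t ℤ.- + 1)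
    (ℤ∣.divides y (trans t≡ (ℤ.+-identityˡ _))))
  go 1 _ t≡ = ℤ∣.∣m⇒∣m*n (t ℤ.+ + 1) (ℤ∣.∣n⇒∣m*n t
    (ℤ∣.divides y (trans (cong (ℤ._- + 1) t≡) (cancel (y ℤ.* + 3)))))
  go 2 _ t≡ = ℤ∣.∣n⇒∣m*n (t ℤ.* (t ℤ.- + 1))
    (ℤ∣.divides (y ℤ.+ + 1) (trans (cong (ℤ._+ + 1) t≡) (collect y)))
  go (suc (suc (suc _))) (s≤s (s≤s (s≤s ()))) _

2∣w12 : ∀ t → 2 ∣ w t 12
2∣w12 t = ∣w12 t (ℤ∣.∣m⇒∣m*n (t ℤ.+ + 1) (2∣t[t-1] t))

3∣w12 : ∀ t → 3 ∣ w t 12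
3∣w12 t = ∣w12 t (3∣[t-1]t[t+1] t)

odd-prime : ∀ {p} → Prime p → p ≢ 2 → ∃ λ h → p ≡ 1 + 2 * h
odd-prime {p} pp p≢2 with p % 2 | m%n<n p 2 | m≡m%n+[m/n]*n p 2
... | 0 | _ | p≡ = ⊥-elim (p≢2 (sym (prime∣prime⇒≡ prime[2] pp (divides (p / 2) p≡))))
... | 1 | _ | p≡ = p / 2 , trans p≡ (cong suc (*-comm (p / 2) 2))
... | suc (suc _) | s≤s (s≤s ()) | _


prime[3] : Prime 3
prime[3] = from-yes (prime? 3)

W-2* : ∀ t m → W t (2 * m) ≡ W t m ℤ.* (V t m ℤ.+ + 2)
W-2* t m = trans (cong (ℤ._- + 2) (V-double t m)) (factor (V t m))
  where
  factor : ∀ x → x ℤ.* x ℤ.- + 2 ℤ.- + 2 ≡ (x ℤ.- + 2) ℤ.* (x ℤ.+ + 2)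
  factor = ℤ-Solver.solve-∀

-- W (p j) / W j is a square s², and modulo p² the number s is p as soon as p divides W j
-- (p ≥ 5), W (j / 3) (p = 3) or W (j / 4) (p = 2).
module _ (t : ℤ) where

  Ramified : ℕ → ℕ → Set
  Ramified p j = ∃ λ v → let s = + p ℤ.* (+ 1 ℤ.+ + p ℤ.* v) in W t (p * j) ≡ W t j ℤ.* (s ℤ.* s)

  -- The quotient is V (4l) + 2 = V (2l)². As V l is even, V (2l) = (V l)² - 2 is 2 modulo 4.
  ramified-2 : ∀ l → 2 ∣ w t l → Ramified 2 (2 * (2 * l))
  ramified-2 l 2∣wl with ℤ∣.∣ᵤ⇒∣ {+ 2} {W t l} 2∣wl
  ... | ℤ∣.divides y Wl≡ = v , trans (W-2* t (2 * (2 * l))) (cong (W t (2 * (2 * l)) ℤ.*_)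
      (trans (cong (ℤ._+ + 2) (V-double t (2 * l))) (trans (cancel (V t (2 * l))) (cong₂ ℤ._*_ V2l≡ V2l≡))))
    where
    v = (+ 1 ℤ.+ y) ℤ.* (+ 1 ℤ.+ y) ℤ.- + 1
    cancel : ∀ x → x ℤ.* x ℤ.- + 2 ℤ.+ + 2 ≡ x ℤ.* x
    cancel = ℤ-Solver.solve-∀
    square : ∀ y → let z = + 2 ℤ.+ y ℤ.* + 2 in
      z ℤ.* z ℤ.- + 2 ≡ + 2 ℤ.* (+ 1 ℤ.+ + 2 ℤ.* ((+ 1 ℤ.+ y) ℤ.* (+ 1 ℤ.+ y) ℤ.- + 1))
    square = ℤ-Solver.solve-∀
    V2l≡ : V t (2 * l) ≡ + 2 ℤ.* (+ 1 ℤ.+ + 2 ℤ.* v)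
    V2l≡ = trans (V-double t l) (trans (cong (λ x → x ℤ.* x ℤ.- + 2)
      (trans (2+W t l) (cong (λ x → + 2 ℤ.+ x) Wl≡))) (square y))

  W-odd-* : ∀ h m → W t ((1 + 2 * h) * m) ≡ W t m ℤ.* (S (+ 2 ℤ.+ W t m) h ℤ.* S (+ 2 ℤ.+ W t m) h)
  W-odd-* h m = trans (cong (ℤ._- + 2) (V-* t (1 + 2 * h) m))
    (trans (proj₁ (S-square (V t m) h)) (cong (λ x → W t m ℤ.* (S x h ℤ.* S x h)) (2+W t m)))

  -- Here s = 3 + W (3l), and 3 ∣ W l makes W (3l) a multiple of 9 by `W-*`.
  ramified-3 : ∀ l → 3 ∣ w t l → Ramified 3 (3 * l)
  ramified-3 l 3∣wl = v , trans (W-odd-* 1 (3 * l)) (cong (λ s → W t (3 * l) ℤ.* (s ℤ.* s)) S≡)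
    where
    3∣Wl : + 3 ℤ∣.∣ W t l
    3∣Wl = ℤ∣.∣ᵤ⇒∣ 3∣wl
    y = ℤ∣._∣_.quotient 3∣Wl
    X = proj₁ (W-* t 3 l)
    v = y ℤ.* (+ 3 ℤ.+ y ℤ.* X)
    factor : ∀ y X → + 2 ℤ.+ y ℤ.* + 3 ℤ.* (+ 3 ℤ.* + 3 ℤ.+ y ℤ.* + 3 ℤ.* X) ℤ.+ + 1
      ≡ + 3 ℤ.* (+ 1 ℤ.+ + 3 ℤ.* (y ℤ.* (+ 3 ℤ.+ y ℤ.* X)))
    factor = ℤ-Solver.solve-∀
    S≡ : + 2 ℤ.+ W t (3 * l) ℤ.+ + 1 ≡ + 3 ℤ.* (+ 1 ℤ.+ + 3 ℤ.* v)
    S≡ = trans (cong (λ x → + 2 ℤ.+ x ℤ.+ + 1) (trans (proj₂ (W-* t 3 l))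
        (cong (λ x → x ℤ.* (+ 3 ℤ.* + 3 ℤ.+ x ℤ.* X)) (ℤ∣._∣_.equality 3∣Wl))))
      (factor y X)

  -- In s = p + c W j + (W j)² Y both c and W j are multiples of p, so the last two terms vanish
  -- modulo p².
  ramified-≥5 : ∀ {p} → Prime p → p ≢ 2 → p ≢ 3 → ∀ j → p ∣ w t j → Ramified p j
  ramified-≥5 {p} pp p≢2 p≢3 j p∣wj with odd-prime pp p≢2
  ... | h , refl with S-expand (W t j) h | ℤ∣.∣ᵤ⇒∣ {+ p} {W t j} p∣wj
  ...   | c , Y , S≡ , 6c≡ | ℤ∣.divides x Wj≡ = v , trans (W-odd-* h j)
      (cong (λ s → W t j ℤ.* (s ℤ.* s)) (trans S≡ (trans
        (trans (cong (λ q → q ℤ.+ c ℤ.* W t j ℤ.+ W t j ℤ.* W t j ℤ.* Y) 1+2h≡p)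
          (cong₂ (λ c w → P ℤ.+ c ℤ.* w ℤ.+ w ℤ.* w ℤ.* Y) (ℤ∣._∣_.equality p∣c) Wj≡))
        (factor P (ℤ∣._∣_.quotient p∣c) x Y))))
    where
    P = + p
    1+2h≡p : + 1 ℤ.+ + 2 ℤ.* + h ≡ P
    1+2h≡p = cong (λ x → + 1 ℤ.+ x) (sym (ℤ.pos-* 2 h))
    6c-multiple : P ℤ∣.∣ + 6 ℤ.* c
    6c-multiple = ℤ∣.divides (+ h ℤ.* (+ h ℤ.+ + 1))
      (trans 6c≡ (cong (λ q → + h ℤ.* (+ h ℤ.+ + 1) ℤ.* q) 1+2h≡p))
    p∤ : ∀ {q} → Prime q → p ≢ q → ¬ p ∣ q
    p∤ pq p≢q = p≢q ∘ prime∣prime⇒≡ pp pq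
    p∣ᵤc : p ∣ ∣ c ∣
    p∣ᵤc with euclidsLemma 6 ∣ c ∣ pp (subst (p ∣_) (ℤ.abs-* (+ 6) c) (ℤ∣.∣⇒∣ᵤ 6c-multiple))
    ... | inj₂ p∣c = p∣c
    ... | inj₁ p∣6 with euclidsLemma 2 3 pp p∣6
    ...   | inj₁ p∣2 = ⊥-elim (p∤ prime[2] p≢2 p∣2)
    ...   | inj₂ p∣3 = ⊥-elim (p∤ prime[3] p≢3 p∣3)
    p∣c : P ℤ∣.∣ c
    p∣c = ℤ∣.∣ᵤ⇒∣ p∣ᵤc
    v = ℤ∣._∣_.quotient p∣c ℤ.* x ℤ.+ x ℤ.* x ℤ.* Y
    factor : ∀ P d x Y → P ℤ.+ d ℤ.* P ℤ.* (x ℤ.* P) ℤ.+ x ℤ.* P ℤ.* (x ℤ.* P) ℤ.* Y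
      ≡ P ℤ.* (+ 1 ℤ.+ P ℤ.* (d ℤ.* x ℤ.+ x ℤ.* x ℤ.* Y))
    factor = ℤ-Solver.solve-∀

-- Absence of a primitive divisor contradicts the size of A

module NoPrimitiveDivisor (t : ℤ) (3≤∣t∣ : 3 ≤ ∣ t ∣) (n : ℕ) (threshold<n : threshold < n)
  (no-primitive : ¬ HasPrimitivePrimeDivisor (W t) n) where

  open Growth t 3≤∣t∣

  instance
    n≢0 : NonZero n
    n≢0 = >-nonZero (≤-trans (s≤s z≤n) threshold<n)

  open PrimeSupport (primeSupport n) renaming (cofactor to m; primes to qs; equality to n≡)

  m≢0 : NonZero m
  m≢0 = m*n≢0⇒m≢0 m {product qs} {{subst NonZero n≡ n≢0}}

  qs≢0 : All NonZero qs
  qs≢0 = All.map prime⇒nonZero allPrime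

  A : ℕ
  A = new m qs

  instance
    A≢0 : NonZero A
    A≢0 = new≢0 {{m≢0}} qs≢0

  A∣w : A ∣ w t n
  A∣w = subst (λ k → A ∣ w t k) (sym n≡) (subst (A ∣_) (new*old m qs) (m∣m*n (old m qs)))

  A∣quotient : ∀ q j R → Prime q → n ≡ q * j → W t (q * j) ≡ W t j ℤ.* R → A ∣ ∣ R ∣
  A∣quotient q j R pq n≡qj W≡ = new-∣-quotient m {{m≢0}} qs≢0 {k = j} {{prime⇒nonZero pq}}
    (complete q pq (subst (q ∣_) (sym n≡qj) (m∣m*n j)))
    (trans (*-comm j q) (trans (sym n≡qj) n≡))
    (trans (cong (w t) (trans (sym n≡) n≡qj)) (trans (cong ∣_∣ W≡) (ℤ.abs-* (W t j) R)))

  small<n : ∀ {k} → k ≤ 48 → k < n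
  small<n k≤48 = ≤-trans (s≤s (≤-trans k≤48 (m≤m*n 48 (512 * 512 * 512)))) threshold<n

  module _ {p : ℕ} (pp : Prime p) (p∣A : p ∣ A) where

    p∣w : p ∣ w t n
    p∣w = ∣-trans p∣A A∣w

    earlier : ∃ λ j → j < n × 1 ≤ j × p ∣ w t j
    earlier = decidable-stable (anyUpTo? (λ j → (1 ≤? j) ×-dec (p ∣? w t j)) n)
      λ none → no-primitive (p , pp , p∣w , λ j 1≤j j<n _ p∣wj → none (j , j<n , 1≤j , p∣wj))

    -- A divides q² + W (n / q) X by `W-*`, and p divides both A and W (n / q), so p divides q.
    unique-prime : ∀ g k → n ≡ k * g → p ∣ w t g → ∀ {q} → Prime q → q ∣ k → p ≡ q
    unique-prime g _ n≡kg p∣wg {q} pq (divides k refl) = prime∣prime⇒≡ pp pq p∣q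
      where
      n≡qj : n ≡ q * (k * g)
      n≡qj = trans n≡kg (rotate k q g)
        where
        rotate : ∀ k q g → k * q * g ≡ q * (k * g)
        rotate = solve-∀
      X = proj₁ (W-* t q (k * g))
      p∣R : + p ℤ∣.∣ + q ℤ.* + q ℤ.+ W t (k * g) ℤ.* X
      p∣R = ℤ∣.∣ᵤ⇒∣ (∣-trans p∣A (A∣quotient q (k * g) _ pq n≡qj (proj₂ (W-* t q (k * g)))))
      p∣q² : p ∣ q * q
      p∣q² = subst (p ∣_) (ℤ.abs-* (+ q) (+ q)) (ℤ∣.∣⇒∣ᵤ {+ p} {+ q ℤ.* + q} (ℤ∣.∣m+n∣n⇒∣m p∣R
        (ℤ∣.∣m⇒∣m*n X (ℤ∣.∣ᵤ⇒∣ {+ p} {W t (k * g)} (w-∣-* t k g p∣wg)))))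
      p∣q : p ∣ q
      p∣q = reduce (euclidsLemma q q pp p∣q²)

    -- Some prime divides n / g, and `unique-prime` identifies it with p.
    climb : ∀ g → g ∣ n → g < n → p ∣ w t g → p * g ∣ n
    climb g (divides k n≡kg) g<n p∣wg = subst (p * g ∣_) (sym n≡kg) (*-monoˡ-∣ g p∣k)
      where
      k≢1 : k ≢ 1
      k≢1 refl = <-irrefl (sym (trans n≡kg (*-identityˡ g))) g<n
      q∣k = primeDivisor k {{m*n≢0⇒m≢0 k {{subst NonZero n≡kg n≢0}}}} k≢1
      p∣k : p ∣ k
      p∣k = subst (_∣ k) (sym (unique-prime g k n≡kg p∣wg (proj₁ (proj₂ q∣k)) (proj₂ (proj₂ q∣k))))
        (proj₂ (proj₂ q∣k))

    g₀ = gcd (proj₁ earlier) n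

    p∣wg₀ : p ∣ w t g₀
    p∣wg₀ = w-∣-gcd t (proj₁ earlier) n (proj₂ (proj₂ (proj₂ earlier))) p∣w

    pg₀∣n : p * g₀ ∣ n
    pg₀∣n = climb g₀ (gcd[m,n]∣n (proj₁ earlier) n)
      (≤-<-trans (∣⇒≤ {{>-nonZero (proj₁ (proj₂ (proj₂ earlier)))}} (gcd[m,n]∣m (proj₁ earlier) n))
        (proj₁ (proj₂ earlier)))
      p∣wg₀

    ramified⇒p³∤A : ∀ j → n ≡ p * j → Ramified t p j → ¬ p * p * p ∣ A
    ramified⇒p³∤A j n≡pj (v , W≡) p³∣A = p³∤[p[1+pv]]² pp v (∣-trans p³∣A (A∣quotient p j _ pp n≡pj W≡))

    p³∤A-≥5 : p ≢ 2 → p ≢ 3 → ¬ p * p * p ∣ A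
    p³∤A-≥5 p≢2 p≢3 = from pg₀∣n
      where
      from : p * g₀ ∣ n → ¬ p * p * p ∣ A
      from (divides c n≡) = ramified⇒p³∤A (c * g₀) (trans n≡ (rotate c p g₀))
        (ramified-≥5 t pp p≢2 p≢3 (c * g₀) (w-∣-* t c g₀ p∣wg₀))
        where
        rotate : ∀ c p g → c * (p * g) ≡ p * (c * g)
        rotate = solve-∀

  private
    g = gcd n 12
    g∣n = gcd[m,n]∣m n 12
    g≤12 = gcd[m,n]≤n n 12

  2³∤A : 2 ∣ A → ¬ 2 * 2 * 2 ∣ A
  -- Three steps give 8g ∣ n, so that `ramified-2` can start from 2 ∣ W (n / 8). The last index
  -- climbed from, 4g, is at most 48.
  2³∤A 2∣A = from (climb prime[2] 2∣A (2 * (2 * g)) 4g∣n (small<n (*-monoʳ-≤ 2 (*-monoʳ-≤ 2 g≤12))) 2∣w4g)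
    where
    2∣wg : 2 ∣ w t g
    2∣wg = w-∣-gcd t n 12 (p∣w prime[2] 2∣A) (2∣w12 t)
    2∣w2g : 2 ∣ w t (2 * g)
    2∣w2g = w-∣-* t 2 g 2∣wg
    2∣w4g : 2 ∣ w t (2 * (2 * g))
    2∣w4g = w-∣-* t 2 (2 * g) 2∣w2g
    2g∣n : 2 * g ∣ n
    2g∣n = climb prime[2] 2∣A g g∣n (small<n (≤-trans g≤12 (m≤m+n 12 36))) 2∣wg
    4g∣n : 2 * (2 * g) ∣ n
    4g∣n = climb prime[2] 2∣A (2 * g) 2g∣n (small<n (≤-trans (*-monoʳ-≤ 2 g≤12) (m≤m+n 24 24))) 2∣w2g
    from : 2 * (2 * (2 * g)) ∣ n → ¬ 2 * 2 * 2 ∣ A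
    from (divides c n≡) = ramified⇒p³∤A prime[2] 2∣A (2 * (2 * (c * g))) (trans n≡ (rotate c g))
      (ramified-2 t (c * g) (w-∣-* t c g 2∣wg))
      where
      rotate : ∀ c g → c * (2 * (2 * (2 * g))) ≡ 2 * (2 * (2 * (c * g)))
      rotate = solve-∀

  3³∤A : 3 ∣ A → ¬ 3 * 3 * 3 ∣ A
  -- Two steps give 9g ∣ n, and `ramified-3` starts from 3 ∣ W (n / 9).
  3³∤A 3∣A = from (climb prime[3] 3∣A (3 * g) 3g∣n (small<n (≤-trans (*-monoʳ-≤ 3 g≤12) (m≤m+n 36 12))) 3∣w3g)
    where
    3∣wg : 3 ∣ w t g
    3∣wg = w-∣-gcd t n 12 (p∣w prime[3] 3∣A) (3∣w12 t)
    3∣w3g : 3 ∣ w t (3 * g)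
    3∣w3g = w-∣-* t 3 g 3∣wg
    3g∣n : 3 * g ∣ n
    3g∣n = climb prime[3] 3∣A g g∣n (small<n (≤-trans g≤12 (m≤m+n 12 36))) 3∣wg
    from : 3 * (3 * g) ∣ n → ¬ 3 * 3 * 3 ∣ A
    from (divides c n≡) = ramified⇒p³∤A prime[3] 3∣A (3 * (c * g)) (trans n≡ (rotate c g))
      (ramified-3 t (c * g) (w-∣-* t c g 3∣wg))
      where
      rotate : ∀ c g → c * (3 * (3 * g)) ≡ 3 * (3 * (c * g))
      rotate = solve-∀

  p³∤A : ∀ p → Prime p → p ∣ A → ¬ p * p * p ∣ A
  p³∤A p pp p∣A = cases p pp p∣A (p ≟ 2) (p ≟ 3)
    where
    cases : ∀ p → Prime p → p ∣ A → Dec (p ≡ 2) → Dec (p ≡ 3) → ¬ p * p * p ∣ A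
    cases _ _  2∣A (yes refl) _          = 2³∤A 2∣A
    cases _ _  3∣A (no _)     (yes refl) = 3³∤A 3∣A
    cases _ pp p∣A (no p≢2)   (no p≢3)   = p³∤A-≥5 pp p∣A p≢2 p≢3

  A≤n² : A ≤ n * n
  A≤n² = ∣⇒≤ {{m*n≢0 n n}} (∣⇒∣n*n n A λ p pp p∣A →
    ∣-trans (m∣m*n (g₀ pp p∣A)) (pg₀∣n pp p∣A) , p³∤A p pp p∣A)

  contradiction : ⊥
  contradiction = <-irrefl refl (begin-strict
    2 ^ e                     ≤⟨ 2^n≤a e ⟩
    a e                       ≤⟨ proj₂ (new-bounds m {{m≢0}} qs≢0 coprime) ⟩
    2 ^ slack (length qs) * A ≤⟨ *-monoʳ-≤ (2 ^ slack (length qs)) A≤n² ⟩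
    2 ^ slack (length qs) * (n * n) ≡⟨ cong (λ k → 2 ^ slack (length qs) * (k * k)) n≡ ⟩
    2 ^ slack (length qs) * (m * product qs * (m * product qs))
      <⟨ totient-dominates m {{m≢0}} allPrime coprime (subst (threshold <_) n≡ threshold<n) ⟩
    2 ^ e                     ∎)
    where
    open ≤-Reasoning
    e = totient m qs

-- Primitive divisors of W and the Zsigmondy bound

W≢0 : ∀ t → 3 ≤ ∣ t ∣ → ∀ n .{{_ : NonZero n}} → W t n ≢ 0ℤ
W≢0 t 3≤∣t∣ n eq = ≢-nonZero⁻¹ (w t n) {{Growth.w≢0 t 3≤∣t∣ n}} (cong ∣_∣ eq)

W-hasPrimitive : ∀ t → 3 ≤ ∣ t ∣ → ∀ n → threshold < n → HasPrimitivePrimeDivisor (W t) n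
W-hasPrimitive t 3≤∣t∣ n threshold<n = decidable-stable
  (hasPrimitive? (W t) n (W≢0 t 3≤∣t∣ n {{>-nonZero (≤-trans (s≤s z≤n) threshold<n)}}))
  (NoPrimitiveDivisor.contradiction t 3≤∣t∣ n threshold<n)

bounded-maximum : ∀ {P : Pred ℕ _} → (∀ n → Dec (P n)) → ∀ c → (∀ n → P n → n ≤ c) →
  Empty P ⊎ ∃ λ z → IsMaximumOf P z × z ≤ c
bounded-maximum P? c bound with P? c
... | yes Pc = inj₂ (c , (Pc , bound) , ≤-refl)
bounded-maximum {P} P? zero bound | no ¬P0 = inj₁ λ n Pn → ¬P0 (subst P (n≤0⇒n≡0 (bound n Pn)) Pn)
bounded-maximum P? (suc c) bound | no ¬Pc
  with bounded-maximum P? c (λ n Pn → s≤s⁻¹ (≤∧≢⇒< (bound n Pn) λ { refl → ¬Pc Pn }))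
... | inj₁ empty           = inj₁ empty
... | inj₂ (z , max , z≤c) = inj₂ (z , max , m≤n⇒m≤1+n z≤c)

hasPrimitive-resp-∣∣ : ∀ {a b : ℕ → ℤ} n → (∀ m → ∣ a m ∣ ≡ ∣ b m ∣) →
  HasPrimitivePrimeDivisor a n → HasPrimitivePrimeDivisor b n
hasPrimitive-resp-∣∣ n eq (p , pp , p∣an , new) = p , pp , subst (p ∣_) (eq n) p∣an ,
  λ m 1≤m m<n bm≢0 p∣bm → new m 1≤m m<n
    (λ am≡0 → bm≢0 (ℤ.∣i∣≡0⇒i≡0 (trans (sym (eq m)) (cong ∣_∣ am≡0))))
    (subst (p ∣_) (sym (eq m)) p∣bm)

Z-bound : ∀ a c → (∀ n → 1 ≤ n → a n ≢ 0ℤ) → (∀ n → c < n → HasPrimitivePrimeDivisor a n) → Z[ a ]≤ c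
Z-bound a c a≢0 h = bounded-maximum dec c λ n (_ , none) → ≮⇒≥ λ c<n → none (h n c<n)
  where
  dec : ∀ n → Dec (ZsigmondySet a n)
  dec zero    = no λ ()
  dec (suc n) = (1 ≤? suc n) ×-dec ¬? (hasPrimitive? a (suc n) (a≢0 (suc n) (s≤s z≤n)))

-- Transfer to units of norm -1

halve : ∀ n → ∃ λ j → n ≡ 2 * j ⊎ n ≡ 1 + 2 * j
halve zero    = 0 , inj₁ refl
halve (suc n) with halve n
... | j , inj₁ n≡ = j , inj₂ (cong suc n≡)
... | j , inj₂ n≡ = suc j , inj₁ (trans (cong suc n≡) (sym (*-suc 2 j)))

-- Here a is Δ for a unit of norm −1 and W t belongs to its square.
module NormMinusOne (a : ℕ → ℤ) (t : ℤ) (3≤∣t∣ : 3 ≤ ∣ t ∣)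
  (a-even : ∀ m → a (2 * m) ≡ ℤ.- W t m)
  (a-odd : ∀ j → a (1 + 2 * j) ℤ.* a (1 + 2 * j) ≡ W t (1 + 2 * j)) where

  ∣a-even∣ : ∀ m → ∣ a (2 * m) ∣ ≡ w t m
  ∣a-even∣ m = trans (cong ∣_∣ (a-even m)) (ℤ.∣-i∣≡∣i∣ (W t m))

  ∣a-odd∣² : ∀ j → ∣ a (1 + 2 * j) ∣ * ∣ a (1 + 2 * j) ∣ ≡ w t (1 + 2 * j)
  ∣a-odd∣² j = trans (sym (ℤ.abs-* (a (1 + 2 * j)) (a (1 + 2 * j)))) (cong ∣_∣ (a-odd j))

  ∣a-odd⇒∣w : ∀ {p} j → p ∣ ∣ a (1 + 2 * j) ∣ → p ∣ w t (1 + 2 * j)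
  ∣a-odd⇒∣w {p} j h = subst (p ∣_) (∣a-odd∣² j) (∣m⇒∣m*n ∣ a (1 + 2 * j) ∣ h)

  -- A prime dividing an earlier a m divides W m for m odd and W (m / 2) for m even, in both cases
  -- at an index below n.
  odd : ∀ j → HasPrimitivePrimeDivisor (W t) (1 + 2 * j) → HasPrimitivePrimeDivisor a (1 + 2 * j)
  odd j (p , pp , p∣w , new) = p , pp ,
      reduce (euclidsLemma ∣ a n ∣ ∣ a n ∣ pp (subst (p ∣_) (sym (∣a-odd∣² j)) p∣w)) ,
      λ m 1≤m m<n _ → go m 1≤m m<n (halve m)
    where
    n = 1 + 2 * j
    go : ∀ m → 1 ≤ m → m < n → (∃ λ i → m ≡ 2 * i ⊎ m ≡ 1 + 2 * i) → ¬ p ∣ ∣ a m ∣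
    go m 1≤m m<n (i , inj₂ refl) p∣a = new m 1≤m m<n (W≢0 t 3≤∣t∣ m) (∣a-odd⇒∣w i p∣a)
    go _ () _ (zero , inj₁ refl)
    go m 1≤m m<n (suc i , inj₁ refl) p∣a = new (suc i) (s≤s z≤n)
      (≤-<-trans (m≤n*m (suc i) 2) m<n) (W≢0 t 3≤∣t∣ (suc i)) (subst (p ∣_) (∣a-even∣ (suc i)) p∣a)

  -- An even m reduces to m / 2 < 2i. An odd m may exceed 2i, so the gcd with 2i is needed to reach
  -- a smaller index.
  multiple-of-4 : ∀ i → HasPrimitivePrimeDivisor (W t) (2 * i) → HasPrimitivePrimeDivisor a (2 * (2 * i))
  multiple-of-4 i (p , pp , p∣w , new) = p , pp , subst (p ∣_) (sym (∣a-even∣ (2 * i))) p∣w ,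
      λ m 1≤m m<n _ → go m 1≤m m<n (halve m)
    where
    k = 2 * i
    go : ∀ m → 1 ≤ m → m < 2 * k → (∃ λ j → m ≡ 2 * j ⊎ m ≡ 1 + 2 * j) → ¬ p ∣ ∣ a m ∣
    go _ () _ (zero , inj₁ refl)
    go m 1≤m m<n (suc j , inj₁ refl) p∣a = new (suc j) (s≤s z≤n) (*-cancelˡ-< 2 (suc j) k m<n)
      (W≢0 t 3≤∣t∣ (suc j)) (subst (p ∣_) (∣a-even∣ (suc j)) p∣a)
    -- gcd(m, k) is a proper divisor of k because m is odd and k is even.
    go m 1≤m m<n (j , inj₂ refl) p∣a = new g 1≤g (≤∧≢⇒< g≤k g≢k) (W≢0 t 3≤∣t∣ g {{g≢0}})
        (w-∣-gcd t m k (∣a-odd⇒∣w j p∣a) p∣w)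
      where
      g = gcd m k
      g≢0 : NonZero g
      g≢0 = subst NonZero (gcd-comm k m) (gcd-nonZeroʳ k m)
      1≤g : 1 ≤ g
      1≤g = >-nonZero⁻¹ g {{g≢0}}
      instance
        k≢0 : NonZero k
        k≢0 = m*n≢0⇒n≢0 2 {{>-nonZero (<-trans 1≤m m<n)}}
      g≤k : g ≤ k
      g≤k = gcd[m,n]≤n m k
      g≢k : g ≢ k
      g≢k g≡k with ∣1⇒≡1 (∣m+n∣m⇒∣n {2} {2 * j} {1} (subst (2 ∣_) (+-comm 1 (2 * j))
        (∣-trans (m∣m*n i) (subst (_∣ m) g≡k (gcd[m,n]∣m m k)))) (m∣m*n j))
      ... | ()

  -- The bound is doubled because for multiples of 4 the index used in W is n / 2.
  hasPrimitive : ∀ n → 2 * threshold < n → n % 4 ≢ 2 → HasPrimitivePrimeDivisor a n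
  hasPrimitive n large n%4≢2 = go (halve n)
    where
    odd-case : ∀ j → n ≡ 1 + 2 * j → HasPrimitivePrimeDivisor a n
    odd-case j n≡ = subst (HasPrimitivePrimeDivisor a) (sym n≡) (odd j (W-hasPrimitive t 3≤∣t∣ (1 + 2 * j)
      (≤-<-trans (m≤n*m threshold 2) (subst (2 * threshold <_) n≡ large))))
    go : (∃ λ j → n ≡ 2 * j ⊎ n ≡ 1 + 2 * j) → HasPrimitivePrimeDivisor a n
    go (j , inj₂ n≡) = odd-case j n≡
    go (j , inj₁ n≡) with halve j
    ... | i , inj₁ j≡ = subst (HasPrimitivePrimeDivisor a) (sym (trans n≡ (cong (2 *_) j≡)))
      (multiple-of-4 i (W-hasPrimitive t 3≤∣t∣ (2 * i)
        (*-cancelˡ-< 2 threshold (2 * i) (subst (2 * threshold <_) (trans n≡ (cong (2 *_) j≡)) large))))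
    ... | i , inj₂ j≡ = ⊥-elim (n%4≢2 (trans (cong (_% 4) (trans n≡ (trans (cong (2 *_) j≡) (expand i))))
        ([m+kn]%n≡m%n 2 i 4)))
      where
      expand : ∀ i → 2 * (1 + 2 * i) ≡ 2 + i * 4
      expand = solve-∀

-- Traces and norms in the quadratic field

square-nonNeg : ∀ c → ℚ.NonNegative (c ℚ.* c)
square-nonNeg c with ℚ.≤-total 0ℚ c
... | inj₁ 0≤c = ℚ.nonNeg*nonNeg⇒nonNeg c {{ℚ.nonNegative 0≤c}} c {{ℚ.nonNegative 0≤c}}
... | inj₂ c≤0 = ℚ.nonPos*nonPos⇒nonPos c {{ℚ.nonPositive c≤0}} c {{ℚ.nonPositive c≤0}}

ι-nonNeg : ∀ k → ℚ.NonNegative (ι (+ k))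
ι-nonNeg k = ℚ.normalize-nonNeg k 1

module Traces (K : RealQuadraticField) where

  open QuadraticField K hiding (_+_; _*_; -_; _-_) renaming (_^_ to _^ᴷ_)
  open QuadraticField K using () renaming (_+_ to _+ᴷ_; _*_ to _*ᴷ_; -_ to -ᴷ_; _-_ to _-ᴷ_)
  open Integrality K
  open ℚ.+-*-Solver using (solve; _:=_; con)
    renaming (_:+_ to _⊕_; _:*_ to _⊗_; :-_ to ⊖_; _:-_ to _⊝_)
  private
    module R = CommutativeRing commutativeRing
    module RP = RingP R.ring
  open RealQuadraticField K using (d)

  trace : Carrier → ℚ
  trace x = re x ℚ.+ re x

  norm-[x-1] : ∀ x → norm (x -ᴷ 1#) ≡ norm x ℚ.- trace x ℚ.+ 1ℚ
  norm-[x-1] x = trans (norm-formula (x -ᴷ 1#)) (trans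
    (solve 3 (λ e a b → (a ⊕ con (ℚ.- 1ℚ)) ⊗ (a ⊕ con (ℚ.- 1ℚ)) ⊝ e ⊗ ((b ⊕ con 0ℚ) ⊗ (b ⊕ con 0ℚ))
      := (a ⊗ a ⊝ e ⊗ (b ⊗ b)) ⊝ (a ⊕ a) ⊕ con 1ℚ) refl D (re x) (im x))
    (cong (λ n → n ℚ.- trace x ℚ.+ 1ℚ) (sym (norm-formula x))))

  norm-[x+1] : ∀ x → norm (x +ᴷ 1#) ≡ norm x ℚ.+ trace x ℚ.+ 1ℚ
  norm-[x+1] x = trans (norm-formula (x +ᴷ 1#)) (trans
    (solve 3 (λ e a b → (a ⊕ con 1ℚ) ⊗ (a ⊕ con 1ℚ) ⊝ e ⊗ ((b ⊕ con 0ℚ) ⊗ (b ⊕ con 0ℚ))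
      := (a ⊗ a ⊝ e ⊗ (b ⊗ b)) ⊕ (a ⊕ a) ⊕ con 1ℚ) refl D (re x) (im x))
    (cong (λ n → n ℚ.+ trace x ℚ.+ 1ℚ) (sym (norm-formula x))))

  -- Cayley-Hamilton, x² = trace x · x - norm x, multiplied by y.
  trace-recurrence : ∀ x y → trace (x *ᴷ (x *ᴷ y)) ≡ trace x ℚ.* trace (x *ᴷ y) ℚ.- norm x ℚ.* trace y
  trace-recurrence x y = trans
    (solve 5 (λ e a b p q →
        let u = a ⊗ p ⊕ e ⊗ (b ⊗ q) ; v = a ⊗ q ⊕ b ⊗ p ; z = a ⊗ u ⊕ e ⊗ (b ⊗ v) in
        z ⊕ z := (a ⊕ a) ⊗ (u ⊕ u) ⊝ (a ⊗ a ⊝ e ⊗ (b ⊗ b)) ⊗ (p ⊕ p)) refl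
      D (re x) (im x) (re y) (im y))
    (cong (λ n → trace x ℚ.* trace (x *ᴷ y) ℚ.- n ℚ.* trace y) (sym (norm-formula x)))

  trace-square : ∀ x → trace (x *ᴷ x) ≡ trace x ℚ.* trace x ℚ.- norm x ℚ.* ι (+ 2)
  trace-square x = subst (λ y → trace (x *ᴷ y) ≡ trace x ℚ.* trace y ℚ.- norm x ℚ.* ι (+ 2))
    (R.*-identityʳ x) (trace-recurrence x 1#)

  discriminant : ∀ x → let c = im x ℚ.+ im x in
    trace x ℚ.* trace x ℚ.- ι (+ 4) ℚ.* norm x ≡ D ℚ.* (c ℚ.* c)
  discriminant x = trans (cong (λ n → trace x ℚ.* trace x ℚ.- ι (+ 4) ℚ.* n) (norm-formula x))
    (solve 3 (λ e a b → (a ⊕ a) ⊗ (a ⊕ a) ⊝ con (ι (+ 4)) ⊗ (a ⊗ a ⊝ e ⊗ (b ⊗ b))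
      := e ⊗ ((b ⊕ b) ⊗ (b ⊕ b))) refl D (re x) (im x))

  -- Integrality is available for the norms of αⁿ - 1; the trace is recovered as norm x + 1 - norm
  -- (x - 1).
  trace-int : ∀ x → IsInt (norm x) → IsInt (norm (x -ᴷ 1#)) → IsInt (trace x)
  trace-int x N∈ℤ N[x-1]∈ℤ = subst IsInt
    (trans (cong (λ m → norm x ℚ.+ 1ℚ ℚ.+ (ℚ.- m)) (norm-[x-1] x)) (cancel (norm x) (trace x)))
    (int-+ (int-+ N∈ℤ (+ 1 , refl)) (int-neg N[x-1]∈ℤ))
    where
    cancel : ∀ n t → n ℚ.+ 1ℚ ℚ.+ (ℚ.- (n ℚ.- t ℚ.+ 1ℚ)) ≡ t
    cancel = solve 2 (λ n t → n ⊕ con 1ℚ ⊕ (⊖ (n ⊝ t ⊕ con 1ℚ)) := t) refl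

  module NormOne (x : Carrier) (N≡1 : norm x ≡ 1ℚ) (t : ℤ) (T≡t : trace x ≡ ι t) where

    norm-^≡1 : ∀ n → norm (x ^ᴷ n) ≡ 1ℚ
    norm-^≡1 zero    = norm-1
    norm-^≡1 (suc n) = trans (norm-* x (x ^ᴷ n)) (cong₂ ℚ._*_ N≡1 (norm-^≡1 n))

    trace-^ : ∀ n → trace (x ^ᴷ n) ≡ ι (V t n)
    trace-^ zero          = refl
    trace-^ (suc zero)    = trans (cong trace (R.*-identityʳ x)) T≡t
    trace-^ (suc (suc n)) = begin
      trace (x *ᴷ (x *ᴷ x ^ᴷ n))
        ≡⟨ trace-recurrence x (x ^ᴷ n) ⟩
      trace x ℚ.* trace (x *ᴷ x ^ᴷ n) ℚ.- norm x ℚ.* trace (x ^ᴷ n)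
        ≡⟨ cong₂ (λ u v → u ℚ.* trace (x *ᴷ x ^ᴷ n) ℚ.- v ℚ.* trace (x ^ᴷ n)) T≡t N≡1 ⟩
      ι t ℚ.* trace (x *ᴷ x ^ᴷ n) ℚ.- 1ℚ ℚ.* trace (x ^ᴷ n)
        ≡⟨ cong₂ (λ u v → ι t ℚ.* u ℚ.- v) (trace-^ (suc n)) (trans (ℚ.*-identityˡ _) (trace-^ n)) ⟩
      ι t ℚ.* ι (V t (suc n)) ℚ.- ι (V t n)
        ≡⟨ trans (cong₂ ℚ._+_ (ι-* t (V t (suc n))) (ι-neg (V t n))) (ι-+ (t ℤ.* V t (suc n)) (ℤ.- V t n)) ⟩
      ι (V t (suc (suc n))) ∎
      where open ≡-Reasoning

    norm-[x^n-1] : ∀ n → norm (x ^ᴷ n -ᴷ 1#) ≡ ι (ℤ.- W t n)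
    norm-[x^n-1] n = begin
      norm (x ^ᴷ n -ᴷ 1#)                            ≡⟨ norm-[x-1] (x ^ᴷ n) ⟩
      norm (x ^ᴷ n) ℚ.- trace (x ^ᴷ n) ℚ.+ 1ℚ        ≡⟨ cong₂ (λ u v → u ℚ.- v ℚ.+ 1ℚ) (norm-^≡1 n) (trace-^ n) ⟩
      1ℚ ℚ.- ι (V t n) ℚ.+ 1ℚ                        ≡⟨ rearrange (ι (V t n)) ⟩
      ℚ.- (ι (V t n) ℚ.+ ι (ℤ.- + 2))                ≡⟨ cong ℚ.-_ (ι-+ (V t n) (ℤ.- + 2)) ⟩
      ℚ.- ι (W t n)                                  ≡⟨ ι-neg (W t n) ⟩
      ι (ℤ.- W t n)                                  ∎
      where
      open ≡-Reasoning
      rearrange : ∀ v → 1ℚ ℚ.- v ℚ.+ 1ℚ ≡ ℚ.- (v ℚ.+ ι (ℤ.- + 2))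
      rearrange = solve 1 (λ v → con 1ℚ ⊝ v ⊕ con 1ℚ := ⊖ (v ⊕ con (ι (ℤ.- + 2)))) refl

    private
      -- The discriminant t² - 4 equals D c² with D ≥ 0. This is where the field being real enters,
      -- and it excludes t = 0 and t = ±1.
      ¬negative : ∀ q → ℚ.Negative q → ι t ℚ.* ι t ℚ.- ι (+ 4) ℚ.* 1ℚ ≢ q
      ¬negative q q<0 eq = ℚ.<-irrefl refl (ℚ.≤-<-trans
        (ℚ.nonNegative⁻¹ q {{subst ℚ.NonNegative Dc²≡q Dc²≥0}})
        (ℚ.negative⁻¹ q {{q<0}}))
        where
        c = im x ℚ.+ im x
        Dc²≥0 : ℚ.NonNegative (D ℚ.* (c ℚ.* c))
        Dc²≥0 = ℚ.nonNeg*nonNeg⇒nonNeg D {{ι-nonNeg d}} (c ℚ.* c) {{square-nonNeg c}}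
        Dc²≡q : D ℚ.* (c ℚ.* c) ≡ q
        Dc²≡q = trans (sym (discriminant x)) (trans
          (cong₂ (λ u v → u ℚ.* u ℚ.- ι (+ 4) ℚ.* v) T≡t N≡1) eq)

    x≡1 : t ≡ + 2 → x ≡ 1#
    x≡1 refl = RP.+-inverseˡ-unique x (-ᴷ 1#) (norm≡0⇒≡0 (x -ᴷ 1#) (trans (norm-[x-1] x)
      (cong₂ (λ u v → u ℚ.- v ℚ.+ 1ℚ) N≡1 T≡t)))

    x≡-1 : t ≡ ℤ.- + 2 → x ≡ -ᴷ 1#
    x≡-1 refl = RP.+-inverseˡ-unique x 1# (norm≡0⇒≡0 (x +ᴷ 1#) (trans (norm-[x+1] x)
      (cong₂ (λ u v → u ℚ.+ v ℚ.+ 1ℚ) N≡1 T≡t)))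

    3≤∣trace∣ : x ≢ 1# → x ≢ -ᴷ 1# → 3 ≤ ∣ t ∣
    3≤∣trace∣ x≢1 x≢-1 = go t refl
      where
      go : ∀ s → t ≡ s → 3 ≤ ∣ s ∣
      go (+ 0)      refl = ⊥-elim (¬negative _ _ refl)
      go (+ 1)      refl = ⊥-elim (¬negative _ _ refl)
      go (+ 2)      t≡   = ⊥-elim (x≢1 (x≡1 t≡))
      go -[1+ 0 ]   refl = ⊥-elim (¬negative _ _ refl)
      go -[1+ 1 ]   t≡   = ⊥-elim (x≢-1 (x≡-1 t≡))
      go (+ suc (suc (suc n)))  _ = s≤s (s≤s (s≤s z≤n))
      go -[1+ suc (suc n) ]     _ = s≤s (s≤s (s≤s z≤n))

  module _ (α : 𝓞) where

    private x = ⟦ α ⟧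

    N[x^n-1]-int : ∀ n → IsInt (norm (x ^ᴷ n -ᴷ 1#))
    N[x^n-1]-int = norm-int x (proj₂ α)

    trace-^-int : ∀ n → IsInt (norm (x ^ᴷ n)) → IsInt (trace (x ^ᴷ n))
    trace-^-int n N∈ℤ = trace-int (x ^ᴷ n) N∈ℤ (N[x^n-1]-int n)

    x^1≡x : x ^ᴷ 1 ≡ x
    x^1≡x = R.*-identityʳ x

    ∃-trace : IsInt (norm x) → IsInt (trace x)
    ∃-trace N∈ℤ = subst (λ y → IsInt (trace y)) x^1≡x
      (trace-^-int 1 (subst (λ y → IsInt (norm y)) (sym x^1≡x) N∈ℤ))

    norm-1⇒Z-bounded : x ≢ 1# → x ≢ -ᴷ 1# → norm x ≡ 1ℚ → Z[ Δ α ]≤ threshold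
    norm-1⇒Z-bounded x≢1 x≢-1 N≡1 = Z-bound (Δ α) threshold
        (λ n 1≤n Δ≡0 → W≢0 t 3≤∣t∣ n {{>-nonZero 1≤n}} (ℤ.∣i∣≡0⇒i≡0 (trans (∣W∣≡∣Δ∣ n) (cong ∣_∣ Δ≡0))))
        (λ n large → hasPrimitive-resp-∣∣ n ∣W∣≡∣Δ∣ (W-hasPrimitive t 3≤∣t∣ n large))
      where
      T∈ℤ = ∃-trace (+ 1 , N≡1)
      t = proj₁ T∈ℤ
      module O = NormOne x N≡1 t (proj₂ T∈ℤ)
      3≤∣t∣ : 3 ≤ ∣ t ∣
      3≤∣t∣ = O.3≤∣trace∣ x≢1 x≢-1
      ∣W∣≡∣Δ∣ : ∀ n → ∣ W t n ∣ ≡ ∣ Δ α n ∣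
      ∣W∣≡∣Δ∣ n = trans (sym (ℤ.∣-i∣≡∣i∣ (W t n)))
        (cong ∣_∣ (sym (ι-injective {Δ α n} {ℤ.- W t n} (trans (Δ-norm α n) (O.norm-[x^n-1] n)))))

    norm--1⇒hasPrimitive : x ≢ 1# → norm x ≡ ℚ.- 1ℚ →
      ∀ n → 2 * threshold < n → n % 4 ≢ 2 → HasPrimitivePrimeDivisor (Δ α) n
    norm--1⇒hasPrimitive x≢1 N≡-1 = NormMinusOne.hasPrimitive (Δ α) t′ (3≤∣s²+2∣ s s≢0) Δ-even Δ-odd
      where
      T∈ℤ = ∃-trace (ℤ.- + 1 , N≡-1)
      s = proj₁ T∈ℤ
      T≡s = proj₂ T∈ℤ
      t′ = s ℤ.* s ℤ.+ + 2

      3≤∣s²+2∣ : ∀ s → s ≢ 0ℤ → 3 ≤ ∣ s ℤ.* s ℤ.+ + 2 ∣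
      3≤∣s²+2∣ (+ 0)      s≢0 = ⊥-elim (s≢0 refl)
      3≤∣s²+2∣ (+ suc n)  _   = +-monoˡ-≤ 2 (s≤s z≤n)
      3≤∣s²+2∣ (-[1+ n ]) _   = +-monoˡ-≤ 2 (s≤s z≤n)

      -- Trace 0 and norm -1 would give norm (x - 1) = -1 - 0 + 1 = 0, hence x = 1.
      s≢0 : s ≢ 0ℤ
      s≢0 s≡0 = x≢1 (RP.+-inverseˡ-unique x (-ᴷ 1#) (norm≡0⇒≡0 (x -ᴷ 1#) (trans (norm-[x-1] x)
        (cong₂ (λ u v → u ℚ.- v ℚ.+ 1ℚ) N≡-1 (trans T≡s (cong ι s≡0))))))

      y = x ^ᴷ 2
      x²≡y : x *ᴷ x ≡ y
      x²≡y = cong (x *ᴷ_) (sym x^1≡x)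
      Ny≡1 : norm y ≡ 1ℚ
      Ny≡1 = trans (cong norm (sym x²≡y)) (trans (norm-* x x) (cong₂ ℚ._*_ N≡-1 N≡-1))
      Ty≡t′ : trace y ≡ ι t′
      Ty≡t′ = begin
        trace y                                            ≡⟨ cong trace x²≡y ⟨
        trace (x *ᴷ x)                                     ≡⟨ trace-square x ⟩
        trace x ℚ.* trace x ℚ.- norm x ℚ.* ι (+ 2)         ≡⟨ cong₂ (λ u v → u ℚ.* u ℚ.- v ℚ.* ι (+ 2)) T≡s N≡-1 ⟩
        ι s ℚ.* ι s ℚ.+ ι (+ 2)                            ≡⟨ cong (ℚ._+ ι (+ 2)) (ι-* s s) ⟩
        ι (s ℤ.* s) ℚ.+ ι (+ 2)                            ≡⟨ ι-+ (s ℤ.* s) (+ 2) ⟩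
        ι t′                                               ∎
        where open ≡-Reasoning
      module O = NormOne y Ny≡1 t′ Ty≡t′

      y^m≡ : ∀ m → y ^ᴷ m ≡ x ^ᴷ (2 * m)
      y^m≡ = Exp.^-assocʳ semiring x 2

      Δ-even : ∀ m → Δ α (2 * m) ≡ ℤ.- W t′ m
      Δ-even m = ι-injective {Δ α (2 * m)} {ℤ.- W t′ m} (trans (Δ-norm α (2 * m))
        (trans (cong (λ z → norm (z -ᴷ 1#)) (sym (y^m≡ m))) (O.norm-[x^n-1] m)))

      -- For n odd, z = xⁿ has norm -1, so norm (z - 1) = - trace z, while (trace z)² = trace (z²) -
      -- 2.
      Δ-odd : ∀ j → Δ α (1 + 2 * j) ℤ.* Δ α (1 + 2 * j) ≡ W t′ (1 + 2 * j)
      Δ-odd j = ι-injective {Δ α n ℤ.* Δ α n} {W t′ n} (begin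
        ι (Δ α n ℤ.* Δ α n)                        ≡⟨ ι-* (Δ α n) (Δ α n) ⟨
        ι (Δ α n) ℚ.* ι (Δ α n)                    ≡⟨ cong₂ ℚ._*_ ιΔ≡ ιΔ≡ ⟩
        (ℚ.- 1ℚ ℚ.- trace z ℚ.+ 1ℚ) ℚ.* (ℚ.- 1ℚ ℚ.- trace z ℚ.+ 1ℚ) ≡⟨ square (trace z) ⟩
        trace z ℚ.* trace z ℚ.- ℚ.- 1ℚ ℚ.* ι (+ 2) ℚ.+ ι (ℤ.- + 2)
          ≡⟨ cong (λ u → trace z ℚ.* trace z ℚ.- u ℚ.* ι (+ 2) ℚ.+ ι (ℤ.- + 2)) Nz≡-1 ⟨
        trace z ℚ.* trace z ℚ.- norm z ℚ.* ι (+ 2) ℚ.+ ι (ℤ.- + 2)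
          ≡⟨ cong (ℚ._+ ι (ℤ.- + 2)) (trace-square z) ⟨
        trace (z *ᴷ z) ℚ.+ ι (ℤ.- + 2)             ≡⟨ cong (λ u → trace u ℚ.+ ι (ℤ.- + 2)) z²≡ ⟩
        trace (y ^ᴷ n) ℚ.+ ι (ℤ.- + 2)             ≡⟨ cong (ℚ._+ ι (ℤ.- + 2)) (O.trace-^ n) ⟩
        ι (V t′ n) ℚ.+ ι (ℤ.- + 2)                 ≡⟨ ι-+ (V t′ n) (ℤ.- + 2) ⟩
        ι (W t′ n)                                 ∎)
        where
        open ≡-Reasoning
        n = 1 + 2 * j
        z = x ^ᴷ n
        Nz≡-1 : norm z ≡ ℚ.- 1ℚ
        Nz≡-1 = trans (norm-* x (x ^ᴷ (2 * j))) (cong₂ ℚ._*_ N≡-1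
          (trans (cong norm (sym (y^m≡ j))) (O.norm-^≡1 j)))
        ιΔ≡ : ι (Δ α n) ≡ ℚ.- 1ℚ ℚ.- trace z ℚ.+ 1ℚ
        ιΔ≡ = trans (Δ-norm α n) (trans (norm-[x-1] z) (cong (λ u → u ℚ.- trace z ℚ.+ 1ℚ) Nz≡-1))
        z²≡ : z *ᴷ z ≡ y ^ᴷ n
        z²≡ = trans (sym (Exp.^-homo-* semiring x n n))
          (trans (cong (x ^ᴷ_) (cong (λ k → n + k) (sym (+-identityʳ n)))) (sym (y^m≡ n)))
        square : ∀ u → (ℚ.- 1ℚ ℚ.- u ℚ.+ 1ℚ) ℚ.* (ℚ.- 1ℚ ℚ.- u ℚ.+ 1ℚ)
          ≡ u ℚ.* u ℚ.- ℚ.- 1ℚ ℚ.* ι (+ 2) ℚ.+ ι (ℤ.- + 2)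
        square = solve 1 (λ u → (con (ℚ.- 1ℚ) ⊝ u ⊕ con 1ℚ) ⊗ (con (ℚ.- 1ℚ) ⊝ u ⊕ con 1ℚ)
          := u ⊗ u ⊝ con (ℚ.- 1ℚ) ⊗ con (ι (+ 2)) ⊕ con (ι (ℤ.- + 2))) refl

corollary1p3 : (K : RealQuadraticField) → let open QuadraticField K in
    (∃ λ (C₁ : ℕ) → 1 ≤ C₁ ×
    (∀ (α : 𝓞) → IsUnit α → ⟦ α ⟧ ≢ 1# → ⟦ α ⟧ ≢ - 1# →
    norm ⟦ α ⟧ ≡ 1ℚ → Z[ Δ α ]≤ C₁))
    ×
    (∃ λ (C₂ : ℕ) → 1 ≤ C₂ ×
    (∀ (α : 𝓞) → IsUnit α → ⟦ α ⟧ ≢ 1# → ⟦ α ⟧ ≢ - 1# →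
    norm ⟦ α ⟧ ≡ ℚ.- 1ℚ →
    ∀ n → C₂ < n → n % 4 ≢ 2 → HasPrimitivePrimeDivisor (Δ α) n))
corollary1p3 K =
    (threshold , s≤s z≤n , λ α _ → norm-1⇒Z-bounded α)
  , (2 * threshold , s≤s z≤n , λ α _ α≢1 _ → norm--1⇒hasPrimitive α α≢1)
  where open Traces K
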